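{- Let $k\ge 2$ and let $T$ be a tree of order $n$ with distance $k$-domination number $\gamma_k=\gamma_k(T)\ge 3$. Then \[ \Pi_1(T)\ge 4^{k\gamma_k-1}(n-k\gamma_k)^2 \quad\text{and}\quad \Pi_2(T)\le 4^{k\gamma_k-1}(n-k\gamma_k)^{n-k\gamma_k}. \] Either equality holds if and only if $T\cong T_{n,k,\gamma_k}$.
   Context: For a graph $G$ with vertex degrees $d_G(u)$: $\Pi_1(G)=\prod_{u\in V(G)}d_G(u)^2$ and $\Pi_2(G)=\prod_{uv\in E(G)}d_G(u)d_G(v)=\prod_{u\in V(G)}d_G(u)^{d_G(u)}$. A set $D\subseteq V(G)$ is a distance $k$-dominating set if every vertex not in $D$ is at distance at most $k$ from some vertex of $D$; $\gamma_k(G)$ is the minimum size of such a set. For positive integers $n,k,s$ with $n\ge (k+1)s$, $T_{n,k,s}$ is the starlike tree obtained from a vertex $c$ by attaching to $c$: one pendent path containing $k$ vertices other than $c$, $s-1$ pendent paths each containing $k+1$ vertices other than $c$, and $n-(k+1)s$ pendent vertices. It has $n$ vertices, $c$ has degree $n-ks$, and there are exactly $ks-1$ vertices of degree $2$. -}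

module Defs where

open import Data.Empty using (⊥)
open import Data.Fin using (Fin; toℕ; _<?_)
open import Data.Fin.Subset using (Subset; _∈_; _∉_; ∣_∣)
open import Data.List using (List; []; _∷_; _++_; length; lookup; map; filter; replicate; allFin; cartesianProduct)
open import Data.List.Relation.Unary.Unique.Propositional using (Unique)
open import Data.Nat using (ℕ; suc; _+_; _*_; _∸_; _^_; _≤_)
open import Data.Nat.ListAction using (product)
open import Data.Nat.Properties using (1+n≢n)
open import Data.Product using (Σ-syntax; ∃-syntax; _×_; _,_; proj₁; proj₂)
open import Data.Sum using (_⊎_; inj₁; inj₂; swap)
open import Function.Bundles using (_↔_; _⇔_; Inverse)
open import Level using (0ℓ)
open import Relation.Binary using (Rel; Symmetric; Decidable)
open import Relation.Binary.Construct.Closure.ReflexiveTransitive using (Star; ε; _◅_; fold)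
open import Relation.Binary.PropositionalEquality using (_≡_; refl; sym)
open import Relation.Nullary using (¬_)
open import Relation.Nullary.Decidable using (_×-dec_)

record Graph (V : Set) : Set₁ where
  field
    Adj       : Rel V 0ℓ
    symmetric : Symmetric Adj
    loopless  : ∀ {v} → ¬ Adj v v

record FiniteGraph (n : ℕ) : Set₁ where
  field
    graph : Graph (Fin n)
  open Graph graph public
  field
    adj? : Decidable Adj

infix 4 _≅_

_≅_ : {V W : Set} → Graph V → Graph W → Set
_≅_ {V} {W} G H =
  Σ[ f ∈ V ↔ W ] (∀ u v → Graph.Adj G u v ⇔ Graph.Adj H (Inverse.to f u) (Inverse.to f v))

module _ {V : Set} (G : Graph V) where
  open Graph G

  Walk : Rel V 0ℓ
  Walk = Star Adj

  walkLength : ∀ {u v} → Walk u v → ℕ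
  walkLength = fold (λ _ _ → ℕ) (λ _ → suc) 0

  vertices : ∀ {u v} → Walk u v → List V
  vertices {u} ε       = u ∷ []
  vertices {u} (_ ◅ w) = u ∷ vertices w

  Connected : Set
  Connected = ∀ u v → Walk u v

  -- A cycle is a path (no repeated vertex) with at least two edges,
  -- together with an edge joining its endpoints.
  Cycle : Set
  Cycle = ∃[ u ] ∃[ v ] Σ[ w ∈ Walk u v ]
            (Unique (vertices w) × 2 ≤ walkLength w × Adj v u)

  record IsTree : Set where
    field
      nonempty  : V
      connected : Connected
      acyclic   : ¬ Cycle

  IsDistance : V → V → ℕ → Set
  IsDistance u v d =
    (Σ[ w ∈ Walk u v ] walkLength w ≡ d) × (∀ (w : Walk u v) → d ≤ walkLength w)

module _ {n : ℕ} (G : FiniteGraph n) where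
  open FiniteGraph G

  degree : Fin n → ℕ
  degree u = length (filter (adj? u) (allFin n))

  -- Each unordered edge is listed once, as the pair (u , v) with u < v.
  edges : List (Fin n × Fin n)
  edges = filter (λ e → (proj₁ e <? proj₂ e) ×-dec adj? (proj₁ e) (proj₂ e))
                 (cartesianProduct (allFin n) (allFin n))

  Π₁ : ℕ
  Π₁ = product (map (λ u → degree u ^ 2) (allFin n))

  Π₂ : ℕ
  Π₂ = product (map (λ e → degree (proj₁ e) * degree (proj₂ e)) edges)

  IsDistanceDominating : ℕ → Subset n → Set
  IsDistanceDominating k D =
    ∀ v → v ∉ D → ∃[ u ] (u ∈ D × ∃[ d ] (IsDistance graph v u d × d ≤ k))

  IsDistanceDominationNumber : ℕ → ℕ → Set
  IsDistanceDominationNumber k γ =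
    (∃[ D ] (IsDistanceDominating k D × ∣ D ∣ ≡ γ)) ×
    (∀ D → IsDistanceDominating k D → γ ≤ ∣ D ∣)

-- The starlike tree whose branches at the centre have the numbers of vertices
-- listed in ls (centre excluded); position 0 of a branch is next to the centre.
data StarlikeVertex (ls : List ℕ) : Set where
  centre : StarlikeVertex ls
  branch : (i : Fin (length ls)) → Fin (lookup ls i) → StarlikeVertex ls

StarlikeAdj : (ls : List ℕ) → Rel (StarlikeVertex ls) 0ℓ
StarlikeAdj ls centre       centre       = ⊥
StarlikeAdj ls centre       (branch i p) = toℕ p ≡ 0
StarlikeAdj ls (branch i p) centre       = toℕ p ≡ 0
StarlikeAdj ls (branch i p) (branch j q) =
  i ≡ j × (suc (toℕ p) ≡ toℕ q ⊎ suc (toℕ q) ≡ toℕ p)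

starlike : (ls : List ℕ) → Graph (StarlikeVertex ls)
starlike ls = record
  { Adj       = StarlikeAdj ls
  ; symmetric = λ {u} {v} → symm u v
  ; loopless  = λ {v} → irr v
  }
  where
  symm : ∀ u v → StarlikeAdj ls u v → StarlikeAdj ls v u
  symm centre       (branch _ _) e       = e
  symm (branch _ _) centre       e       = e
  symm (branch _ _) (branch _ _) (e , a) = sym e , swap a

  irr : ∀ v → ¬ StarlikeAdj ls v v
  irr (branch _ p) (_ , inj₁ e) = 1+n≢n e
  irr (branch _ p) (_ , inj₂ e) = 1+n≢n e

-- The tree T_{n,k,s} is meant for s ≥ 1 and (k + 1) s ≤ n, where the truncated
-- subtractions are exact.  For s ≥ 1 and n < (k + 1) s the graph below has
-- (k + 1) s vertices, so it is not isomorphic to any graph of order n.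
branchLengths : (n k s : ℕ) → List ℕ
branchLengths n k s =
  k ∷ replicate (s ∸ 1) (k + 1) ++ replicate (n ∸ (k + 1) * s) 1

T[_,_,_] : (n k s : ℕ) → Graph (StarlikeVertex (branchLengths n k s))
T[ n , k , s ] = starlike (branchLengths n k s)

{-# OPTIONS --safe #-}
module Submission where

open import Defs
open import Algebra.Structures using (IsCommutativeMonoid)
open import Data.Bool using (if_then_else_; true; false)
open import Data.Empty using (⊥-elim)
open import Data.Fin using (Fin; zero; suc; toℕ; fromℕ<; cast)
import Data.Fin as Fin
import Data.Fin.Properties as Fin
open import Data.Fin.Subset using (Subset; inside; outside; ∣_∣) renaming (_∈_ to _∈ˢ_; ⊥ to ∅)
open import Data.Fin.Subset.Properties using (∣⊥∣≡0; ∣p∣≤∣x∷p∣)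
open import Data.List
  using (List; []; _∷_; _++_; length; lookup; filter; allFin; map; foldr; cartesianProduct; concat; upTo; replicate)
open import Data.List.Membership.DecPropositional using () renaming (_∈?_ to mem?)
open import Data.List.Membership.Propositional using (_∈_)
open import Data.List.Membership.Propositional.Properties
  using (∈-∃++; ∈-++⁻; ∈-++⁺ˡ; ∈-++⁺ʳ; ∈-filter⁺; ∈-filter⁻; ∈-allFin; ∈-lookup; ∈-map⁺; ∈-map⁻; ∈-concat⁺′; ∈-upTo⁺)
open import Data.List.Properties
  using (length-map; length-++; length-tabulate; length-replicate; length-upTo; map-++; map-replicate; map-tabulate; tabulate-lookup)
open import Data.List.Relation.Binary.Permutation.Propositional using (_↭_; prep; swap; ↭⇒↭ₛ; ↭-refl; ↭-trans; ↭-sym)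
import Data.List.Relation.Binary.Permutation.Propositional.Properties as ↭
import Data.List.Relation.Binary.Permutation.Setoid as Permutationₛ
import Data.List.Relation.Binary.Permutation.Setoid.Properties as Permutationₛ
open import Data.List.Relation.Unary.All using (All; []; _∷_) renaming (lookup to lookupAll; tabulate to tabulateAll)
import Data.List.Relation.Unary.All.Properties as All
open import Data.List.Relation.Unary.AllPairs using ([]; _∷_)
open import Data.List.Relation.Unary.Any using (here; there; index)
open import Data.List.Relation.Unary.Any.Properties using (lookup-index)
open import Data.List.Relation.Unary.Unique.Propositional using (Unique)
import Data.List.Relation.Unary.Unique.Propositional.Properties as Unique
open import Data.Nat
open import Data.Nat.DivMod
open import Data.Nat.ListAction using (sum; product)
open import Data.Nat.ListAction.Properties using (sum-↭; sum-++)
open import Data.Nat.Properties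
open import Data.List.Extrema ≤-totalOrder using (argmax; f[xs]≤f[argmax])
open import Data.Nat.Tactic.RingSolver using (solve-∀)
open import Data.Product using (Σ-syntax; ∃-syntax; _×_; _,_; proj₁; proj₂)
open import Data.Sum using (_⊎_; inj₁; inj₂) renaming (swap to ⊎-swap)
open import Data.Vec using (_∷_)
import Data.Vec as Vec
open import Function using (_∘_; id)
open import Function.Bundles using (_↔_; _⇔_; Inverse; mk⇔; mk↔ₛ′; Equivalence)
open import Relation.Binary.Construct.Closure.ReflexiveTransitive using (ε; _◅_; _◅◅_)
open import Relation.Binary.Definitions using (tri<; tri≈; tri>)
open import Relation.Binary.PropositionalEquality
open import Relation.Nullary
open import Relation.Nullary.Decidable using (map′; _×-dec_; ¬?; decidable-stable)

-- Let I be the number of vertices of degree at least 2 and X the sum of d(v) ∸ 2.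
-- The handshake identity gives n = I + X + 2.
--
-- First, k γ ≤ I.  Let a be a vertex farthest from some fixed root, and label
-- the vertices by their distance from a.  For each residue class modulo k, the
-- internal vertices with positive label in that class form a distance
-- k-dominating set: from a vertex of large label walk towards a, and a vertex
-- of small label is at distance at most i ≤ k from the vertex labelled i on
-- the path from a to the root, because a is deepest.
--
-- Secondly, merging the excesses of two branching vertices, or trading a vertex
-- of degree 2 for one more unit of excess, strictly decreases Π₁ and strictly
-- increases Π₂.  Hence the bounds, with equality only if I = k γ and there is a
-- single vertex of degree > 2, so that T is starlike.
--
-- Thirdly, let a starlike tree with I = k γ have branches of lengths l.  The
-- centre and q(l) = ⌊(l + k) / (2k + 1)⌋ vertices on each branch dominate, and
-- l ∸ 1 = k q(l) + r(l) with Σ r < k, so that q ≤ 1 everywhere.  If q = 1 on branch i,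
-- the vertices at distance k from the leaves dominate without the centre
-- unless some branch j with q = 0 has r(i) + r(j) ≥ k ∸ 1.  As γ ≥ 3 there are two
-- such i, which forces r = 0 except on one branch of length k.

-- Lists without repetition, and subsets given by lists

-- Each head of `xs` is located in `ys` and moved to the front by a permutation; the tail does not
-- repeat it and so embeds in what remains. A constant `f` compares cardinalities, and the
-- remainders `r` compare partial with full sums.
Unique-sum-≤ : {A : Set} (f : A → ℕ) {xs ys : List A} → Unique xs → (∀ {x} → x ∈ xs → x ∈ ys) →
               sum (map f xs) ≤ sum (map f ys)
Unique-sum-≤ f {[]} _ _ = z≤n
Unique-sum-≤ f {x ∷ xs} (x∉ ∷ u) sub with ∈-∃++ (sub (here refl))
... | as , bs , refl = begin
  f x + sum (map f xs)                        ≤⟨ +-monoʳ-≤ (f x) (Unique-sum-≤ f u sub′) ⟩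
  sum (map f (x ∷ as ++ bs))                  ≡⟨ sum-↭ (↭.map⁺ f (↭.shift x as bs)) ⟨
  sum (map f (as ++ x ∷ bs))                  ∎
  where
  open ≤-Reasoning
  sub′ : ∀ {y} → y ∈ xs → y ∈ as ++ bs
  sub′ y∈ with ∈-++⁻ as (sub (there y∈))
  ... | inj₁ y∈as = ∈-++⁺ˡ y∈as
  ... | inj₂ (here refl) = ⊥-elim (lookupAll x∉ y∈ refl)
  ... | inj₂ (there y∈bs) = ∈-++⁺ʳ as y∈bs

length≡sum : {A : Set} (xs : List A) → length xs ≡ sum (map (λ _ → 1) xs)
length≡sum []       = refl
length≡sum (x ∷ xs) = cong suc (length≡sum xs)

Unique-length-≤ : {A : Set} {xs ys : List A} → Unique xs → (∀ {x} → x ∈ xs → x ∈ ys) →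
                  length xs ≤ length ys
Unique-length-≤ {xs = xs} {ys} u sub =
  subst₂ _≤_ (sym (length≡sum xs)) (sym (length≡sum ys)) (Unique-sum-≤ (λ _ → 1) u sub)

insert : ∀ {n} → Fin n → Subset n → Subset n
insert zero    (_ ∷ p) = inside ∷ p
insert (suc x) (b ∷ p) = b ∷ insert x p

∣insert∣ : ∀ {n} (x : Fin n) p → ∣ insert x p ∣ ≤ suc ∣ p ∣
∣insert∣ zero    (b ∷ p)       = s≤s (∣p∣≤∣x∷p∣ b p)
∣insert∣ (suc x) (inside ∷ p)  = s≤s (∣insert∣ x p)
∣insert∣ (suc x) (outside ∷ p) = ∣insert∣ x p

insert-self : ∀ {n} (x : Fin n) p → x ∈ˢ insert x p
insert-self zero    (_ ∷ p) = Vec.here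
insert-self (suc x) (_ ∷ p) = Vec.there (insert-self x p)

insert-mono : ∀ {n} (x : Fin n) {p y} → y ∈ˢ p → y ∈ˢ insert x p
insert-mono zero    Vec.here = Vec.here
insert-mono zero    (Vec.there y∈) = Vec.there y∈
insert-mono (suc x) Vec.here = Vec.here
insert-mono (suc x) (Vec.there y∈) = Vec.there (insert-mono x y∈)

fromList : ∀ {n} → List (Fin n) → Subset n
fromList []       = ∅
fromList (x ∷ xs) = insert x (fromList xs)

∣fromList∣ : ∀ {n} (xs : List (Fin n)) → ∣ fromList xs ∣ ≤ length xs
∣fromList∣ {n} []  = ≤-reflexive (∣⊥∣≡0 n)
∣fromList∣ (x ∷ xs) = ≤-trans (∣insert∣ x (fromList xs)) (s≤s (∣fromList∣ xs))

∈-fromList : ∀ {n} {x : Fin n} {xs} → x ∈ xs → x ∈ˢ fromList xs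
∈-fromList {xs = x ∷ xs} (here refl) = insert-self x (fromList xs)
∈-fromList {xs = x ∷ xs} (there x∈)  = insert-mono x (∈-fromList x∈)

-- Walks of bounded length and distances

-- Walks bound distances only from above; this search upwards from 0, bounded by a known walk
-- length, finds the exact distance.
least : {P : ℕ → Set} → (∀ m → Dec (P m)) → ∀ m → P m → ∃[ d ] (P d × d ≤ m × (∀ j → P j → d ≤ j))
least P? m p with P? 0
... | yes p₀ = 0 , p₀ , z≤n , λ _ _ → z≤n
least P? zero p | no ¬p₀ = ⊥-elim (¬p₀ p)
least {P} P? (suc m) p | no ¬p₀ with least (P? ∘ suc) m p
... | d , pd , d≤m , min = suc d , pd , s≤s d≤m , λ { zero q → ⊥-elim (¬p₀ q) ; (suc j) q → s≤s (min j q) }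

module _ {V : Set} (G : Graph V) where
  open Graph G

  -- Bounded walks stand in for distances: they concatenate and reverse without any minimality
  -- argument, and `distance-exists` recovers a distance at the end.
  WithinDistance : ℕ → V → V → Set
  WithinDistance m u v = Σ[ w ∈ Walk G u v ] walkLength G w ≤ m

  walkLength-◅◅ : ∀ {u v x} (w : Walk G u v) (w′ : Walk G v x) →
                  walkLength G (w ◅◅ w′) ≡ walkLength G w + walkLength G w′
  walkLength-◅◅ ε w′       = refl
  walkLength-◅◅ (_ ◅ w) w′ = cong suc (walkLength-◅◅ w w′)

  within-refl : ∀ {m u} → WithinDistance m u u
  within-refl = ε , z≤n

  within-trans : ∀ {a b u v x} → WithinDistance a u v → WithinDistance b v x → WithinDistance (a + b) u x
  within-trans (w , p) (w′ , q) = w ◅◅ w′ , ≤-trans (≤-reflexive (walkLength-◅◅ w w′)) (+-mono-≤ p q)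

  within-weaken : ∀ {a b u v} → a ≤ b → WithinDistance a u v → WithinDistance b u v
  within-weaken a≤b (w , p) = w , ≤-trans p a≤b

  within-sym : ∀ {a u v} → WithinDistance a u v → WithinDistance a v u
  within-sym (ε , _) = ε , z≤n
  within-sym {suc a} (e ◅ w , s≤s p) =
    within-weaken (≤-reflexive (+-comm a 1))
      (within-trans (within-sym (w , p)) (symmetric e ◅ ε , ≤-refl))

module _ {n : ℕ} (T : FiniteGraph n) where
  open FiniteGraph T

  -- A first step leads to one of finitely many vertices, so the question reduces to walks that are
  -- one edge shorter.
  walkOfLength? : ∀ v m u → Dec (Σ[ w ∈ Walk graph u v ] walkLength graph w ≡ m)
  walkOfLength? v zero u =
    map′ (λ { refl → ε , refl }) (λ { (ε , _) → refl }) (u Fin.≟ v)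
  walkOfLength? v (suc m) u =
    map′ (λ { (x , e , w , p) → e ◅ w , cong suc p })
         (λ { (_◅_ {j = x} e w , p) → x , e , w , suc-injective p })
         (Fin.any? λ x → adj? u x ×-dec walkOfLength? v m x)

  distance-exists : ∀ {u v} (w : Walk graph u v) →
                    ∃[ d ] (IsDistance graph u v d × d ≤ walkLength graph w)
  distance-exists {u} {v} w with least (λ m → walkOfLength? v m u) (walkLength graph w) (w , refl)
  ... | d , p , d≤ , min = d , (p , λ w′ → min _ (w′ , refl)) , d≤

  -- Repetitions in `xs` are harmless, since `fromList` does not increase cardinality, and a walk of
  -- length at most k bounds the distance.
  covering-list-length : ∀ {k γ} → IsDistanceDominationNumber T k γ → (xs : List (Fin n)) →
                         (∀ v → ∃[ u ] (u ∈ xs × WithinDistance graph k v u)) → γ ≤ length xs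
  covering-list-length (_ , min) xs cover = ≤-trans (min (fromList xs) dominates) (∣fromList∣ xs)
    where
    dominates : IsDistanceDominating T _ (fromList xs)
    dominates v _ with cover v
    ... | u , u∈ , w , p with distance-exists w
    ... | d , isd , d≤ = u , ∈-fromList u∈ , d , isd , ≤-trans d≤ p

  degree-≥ : ∀ {u xs} → Unique xs → (∀ {v} → v ∈ xs → Adj u v) → length xs ≤ degree T u
  degree-≥ {u} uniq adj =
    Unique-length-≤ uniq (λ v∈ → ∈-filter⁺ (adj? u) (∈-allFin _) (adj v∈))

  degree-≤ : ∀ {u xs} → (∀ v → Adj u v → v ∈ xs) → degree T u ≤ length xs
  degree-≤ {u} sub =
    Unique-length-≤ (Unique.filter⁺ (adj? u) (Unique.allFin⁺ n))
      (λ v∈ → sub _ (proj₂ (∈-filter⁻ (adj? u) {xs = allFin n} v∈)))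

-- Edge counting

-- Sums and products are handled together: the double counting of edges then serves both the
-- handshake identity and the passage from edges to vertices in `Π₂`.
module BigOp {_∙_ : ℕ → ℕ → ℕ} {e : ℕ} (M : IsCommutativeMonoid _≡_ _∙_ e) where
  open IsCommutativeMonoid M using (assoc; comm; identityˡ; identityʳ)

  ⨁ : {A : Set} → (A → ℕ) → List A → ℕ
  ⨁ f xs = foldr _∙_ e (map f xs)

  private
    interchange : ∀ a b c d → (a ∙ b) ∙ (c ∙ d) ≡ (a ∙ c) ∙ (b ∙ d)
    interchange a b c d = begin
      (a ∙ b) ∙ (c ∙ d) ≡⟨ assoc a b _ ⟩
      a ∙ (b ∙ (c ∙ d)) ≡⟨ cong (a ∙_) (assoc b c d) ⟨
      a ∙ ((b ∙ c) ∙ d) ≡⟨ cong (λ z → a ∙ (z ∙ d)) (comm b c) ⟩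
      a ∙ ((c ∙ b) ∙ d) ≡⟨ cong (a ∙_) (assoc c b d) ⟩
      a ∙ (c ∙ (b ∙ d)) ≡⟨ assoc a c _ ⟨
      (a ∙ c) ∙ (b ∙ d) ∎
      where open ≡-Reasoning

  ⨁-cong : {A : Set} {f g : A → ℕ} (xs : List A) → (∀ x → f x ≡ g x) → ⨁ f xs ≡ ⨁ g xs
  ⨁-cong []       eq = refl
  ⨁-cong (x ∷ xs) eq = cong₂ _∙_ (eq x) (⨁-cong xs eq)

  ⨁-const : {A : Set} (xs : List A) → ⨁ (λ _ → e) xs ≡ e
  ⨁-const []       = refl
  ⨁-const (x ∷ xs) = trans (identityˡ _) (⨁-const xs)

  ⨁-distrib : {A : Set} (f g : A → ℕ) (xs : List A) → ⨁ (λ x → f x ∙ g x) xs ≡ ⨁ f xs ∙ ⨁ g xs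
  ⨁-distrib f g []       = sym (identityˡ e)
  ⨁-distrib f g (x ∷ xs) = trans (cong (_ ∙_) (⨁-distrib f g xs)) (interchange _ _ _ _)

  ⨁-comm : {A B : Set} (f : A → B → ℕ) (xs : List A) (ys : List B) →
           ⨁ (λ x → ⨁ (f x) ys) xs ≡ ⨁ (λ y → ⨁ (λ x → f x y) xs) ys
  ⨁-comm f []       ys = sym (⨁-const ys)
  ⨁-comm f (x ∷ xs) ys = trans (cong (_ ∙_) (⨁-comm f xs ys)) (sym (⨁-distrib (f x) _ ys))

  ⨁-++ : {A : Set} (f : A → ℕ) (xs ys : List A) → ⨁ f (xs ++ ys) ≡ ⨁ f xs ∙ ⨁ f ys
  ⨁-++ f []       ys = sym (identityˡ _)
  ⨁-++ f (x ∷ xs) ys = trans (cong (_ ∙_) (⨁-++ f xs ys)) (sym (assoc _ _ _))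

  ⨁-map : {A B : Set} (f : B → ℕ) (h : A → B) (xs : List A) → ⨁ f (map h xs) ≡ ⨁ (f ∘ h) xs
  ⨁-map f h []       = refl
  ⨁-map f h (x ∷ xs) = cong (_ ∙_) (⨁-map f h xs)

  ⨁-cartesianProduct : {A B : Set} (f : A × B → ℕ) (xs : List A) (ys : List B) →
                       ⨁ f (cartesianProduct xs ys) ≡ ⨁ (λ x → ⨁ (λ y → f (x , y)) ys) xs
  ⨁-cartesianProduct f []       ys = refl
  ⨁-cartesianProduct f (x ∷ xs) ys = begin
    ⨁ f (map (x ,_) ys ++ cartesianProduct xs ys)         ≡⟨ ⨁-++ f (map (x ,_) ys) _ ⟩
    ⨁ f (map (x ,_) ys) ∙ ⨁ f (cartesianProduct xs ys)
      ≡⟨ cong₂ _∙_ (⨁-map f (x ,_) ys) (⨁-cartesianProduct f xs ys) ⟩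
    ⨁ (λ y → f (x , y)) ys ∙ ⨁ (λ x → ⨁ (λ y → f (x , y)) ys) xs ∎
    where open ≡-Reasoning

  -- An indicator with the neutral element for a failed test, so that a fold over a filtered list
  -- becomes a fold over the whole list.
  when : {P : Set} → Dec P → ℕ → ℕ
  when P? a = if does P? then a else e

  when-yes : {P : Set} (P? : Dec P) {a : ℕ} → P → when P? a ≡ a
  when-yes (yes _) _ = refl
  when-yes (no ¬p) p = ⊥-elim (¬p p)

  when-no : {P : Set} (P? : Dec P) {a : ℕ} → ¬ P → when P? a ≡ e
  when-no (yes p) ¬p = ⊥-elim (¬p p)
  when-no (no _)  _  = refl

  when-∙ : {P : Set} (P? : Dec P) (a b : ℕ) → when P? (a ∙ b) ≡ when P? a ∙ when P? b
  when-∙ (yes _) a b = refl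
  when-∙ (no _)  a b = sym (identityˡ e)

  -- Meant for adjacency, whose two orientations exclude each other: by the order of the ends in
  -- `Π₂-vertices`, by the roles of parent and child in `handshake`.
  when-split : {P Q R : Set} (P? : Dec P) (Q? : Dec Q) (R? : Dec R) →
               (P → Q ⊎ R) → (Q → P) → (R → P) → (Q → ¬ R) →
               ∀ a → when P? a ≡ when Q? a ∙ when R? a
  when-split P? (yes q) R? f g h x a =
    trans (when-yes P? (g q)) (sym (trans (cong (a ∙_) (when-no R? (x q))) (identityʳ a)))
  when-split P? (no ¬q) (yes r) f g h x a = trans (when-yes P? (h r)) (sym (identityˡ a))
  when-split P? (no ¬q) (no ¬r) f g h x a =
    trans (when-no P? λ p → case⊎ (f p)) (sym (identityˡ e))
    where
    case⊎ : _ ⊎ _ → _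
    case⊎ (inj₁ q) = ¬q q
    case⊎ (inj₂ r) = ¬r r

  ⨁-filter : {A : Set} {P : A → Set} (P? : ∀ x → Dec (P x)) (f : A → ℕ) (xs : List A) →
             ⨁ f (filter P? xs) ≡ ⨁ (λ x → when (P? x) (f x)) xs
  ⨁-filter P? f [] = refl
  ⨁-filter P? f (x ∷ xs) with does (P? x)
  ... | true  = cong (_ ∙_) (⨁-filter P? f xs)
  ... | false = trans (⨁-filter P? f xs) (sym (identityˡ _))

module Sum = BigOp +-0-isCommutativeMonoid
module Prod = BigOp *-1-isCommutativeMonoid

length-allFin : ∀ n → length (allFin n) ≡ n
length-allFin n = length-tabulate id

length-filter≡ : {A : Set} {P : A → Set} (P? : ∀ x → Dec (P x)) (xs : List A) →
                 length (filter P? xs) ≡ Sum.⨁ (λ x → Sum.when (P? x) 1) xs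
length-filter≡ P? xs = trans (length≡sum (filter P? xs)) (Sum.⨁-filter P? (λ _ → 1) xs)

count-≡ : ∀ {n} (a : Fin n) → Sum.⨁ (λ v → Sum.when (a Fin.≟ v) 1) (allFin n) ≡ 1
count-≡ {n} a = trans (sym (length-filter≡ (a Fin.≟_) (allFin n))) (≤-antisym
  (Unique-length-≤ {ys = a ∷ []} (Unique.filter⁺ (a Fin.≟_) (Unique.allFin⁺ n))
    (λ x∈ → here (sym (proj₂ (∈-filter⁻ (a Fin.≟_) {xs = allFin n} x∈)))))
  (Unique-length-≤ {xs = a ∷ []} ([] ∷ []) (λ { (here refl) → ∈-filter⁺ (a Fin.≟_) (∈-allFin a) refl })))

prod-when : ∀ {A : Set} {P : A → Set} (P? : ∀ x → Dec (P x)) (a : ℕ) (xs : List A) →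
            Prod.⨁ (λ x → Prod.when (P? x) a) xs ≡ a ^ length (filter P? xs)
prod-when P? a [] = refl
prod-when P? a (x ∷ xs) with does (P? x)
... | true  = cong (a *_) (prod-when P? a xs)
... | false = trans (*-identityˡ _) (prod-when P? a xs)

module _ {n : ℕ} (T : FiniteGraph n) where
  open FiniteGraph T

  -- The two factors of an edge are separated, and in the second product the names of the ends are
  -- exchanged. Both orientations together run over all adjacent pairs, so `d u` occurs once for
  -- each neighbour of `u`.
  Π₂-vertices : Π₂ T ≡ product (map (λ u → degree T u ^ degree T u) (allFin n))
  Π₂-vertices = begin
    Prod.⨁ (λ e → d (proj₁ e) * d (proj₂ e)) (edges T)
      ≡⟨ Prod.⨁-filter _ _ (cartesianProduct vs vs) ⟩
    Prod.⨁ (λ e → when (E? (proj₁ e) (proj₂ e)) (d (proj₁ e) * d (proj₂ e))) (cartesianProduct vs vs)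
      ≡⟨ Prod.⨁-cartesianProduct _ vs vs ⟩
    Prod.⨁ (λ u → Prod.⨁ (λ v → when (E? u v) (d u * d v)) vs) vs
      ≡⟨ Prod.⨁-cong vs (λ u → trans (Prod.⨁-cong vs (λ v → Prod.when-∙ (E? u v) (d u) (d v)))
                                     (Prod.⨁-distrib _ _ vs)) ⟩
    Prod.⨁ (λ u → Prod.⨁ (λ v → when (E? u v) (d u)) vs * Prod.⨁ (λ v → when (E? u v) (d v)) vs) vs
      ≡⟨ Prod.⨁-distrib _ _ vs ⟩
    Prod.⨁ (λ u → Prod.⨁ (λ v → when (E? u v) (d u)) vs) vs *
    Prod.⨁ (λ u → Prod.⨁ (λ v → when (E? u v) (d v)) vs) vs
      ≡⟨ cong (Prod.⨁ (λ u → Prod.⨁ (λ v → when (E? u v) (d u)) vs) vs *_) (Prod.⨁-comm (λ u v → when (E? u v) (d v)) vs vs) ⟩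
    Prod.⨁ (λ u → Prod.⨁ (λ v → when (E? u v) (d u)) vs) vs *
    Prod.⨁ (λ u → Prod.⨁ (λ v → when (E? v u) (d u)) vs) vs
      ≡⟨ Prod.⨁-distrib _ _ vs ⟨
    Prod.⨁ (λ u → Prod.⨁ (λ v → when (E? u v) (d u)) vs * Prod.⨁ (λ v → when (E? v u) (d u)) vs) vs
      ≡⟨ Prod.⨁-cong vs (λ u → trans (sym (Prod.⨁-distrib _ _ vs))
                                     (Prod.⨁-cong vs (λ v → sym (orient u v)))) ⟩
    Prod.⨁ (λ u → Prod.⨁ (λ v → when (adj? u v) (d u)) vs) vs
      ≡⟨ Prod.⨁-cong vs (λ u → prod-when (adj? u) (d u) vs) ⟩
    Prod.⨁ (λ u → d u ^ d u) vs ∎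
    where
    open ≡-Reasoning
    open Prod using (when)
    d = degree T
    vs = allFin n
    E? : ∀ u v → Dec (u Fin.< v × Adj u v)
    E? u v = (u Fin.<? v) ×-dec adj? u v
    orient : ∀ u v → when (adj? u v) (d u) ≡ when (E? u v) (d u) * when (E? v u) (d u)
    orient u v = Prod.when-split (adj? u v) (E? u v) (E? v u) split proj₂ (symmetric ∘ proj₂)
                   (λ (u<v , _) (v<u , _) → Fin.<-asym u<v v<u) (d u)
      where
      split : Adj u v → (u Fin.< v × Adj u v) ⊎ (v Fin.< u × Adj v u)
      split a with Fin.<-cmp u v
      ... | tri< u<v _ _ = inj₁ (u<v , a)
      ... | tri≈ _ refl _ = ⊥-elim (loopless a)
      ... | tri> _ _ v<u = inj₂ (v<u , symmetric a)

-- Rooted trees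

module _ {n : ℕ} (G : Graph (Fin n)) where

  dropTo : ∀ {u v x} (w : Walk G u v) → Unique (vertices G w) → x ∈ vertices G w →
           Σ[ w′ ∈ Walk G x v ] Unique (vertices G w′)
  dropTo ε uq (here refl) = ε , uq
  dropTo (e ◅ w) uq (here refl) = e ◅ w , uq
  dropTo (e ◅ w) (_ ∷ uq) (there x∈) = dropTo w uq x∈

  -- Loops are cut out from the far end: if the new first vertex already occurs on the
  -- repetition-free rest, only the part from that occurrence on is kept.
  path : ∀ {u v} → Walk G u v → Σ[ w ∈ Walk G u v ] Unique (vertices G w)
  path ε = ε , [] ∷ []
  path (_◅_ {i = u} e w) with path w
  ... | w′ , uq with mem? Fin._≟_ u (vertices G w′)
  ... | yes u∈ = dropTo w′ uq u∈
  ... | no  u∉ = e ◅ w′ , All.¬Any⇒All¬ _ u∉ ∷ uq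

module Rooted {n : ℕ} (T : FiniteGraph n) (tree : IsTree (FiniteGraph.graph T)) (c : Fin n) where
  open FiniteGraph T
  open IsTree tree

  abstract
    distance : ∀ v → ∃[ d ] IsDistance graph v c d
    distance v with distance-exists T (connected v c)
    ... | d , isd , _ = d , isd

  depth : Fin n → ℕ
  depth v = proj₁ (distance v)

  depth≤ : ∀ {v} (w : Walk graph v c) → depth v ≤ walkLength graph w
  depth≤ {v} = proj₂ (proj₂ (distance v))

  depth-root : depth c ≡ 0
  depth-root = n≤0⇒n≡0 (depth≤ ε)

  -- The first step of a shortest walk to the root works: a shorter route from there would shorten
  -- the whole walk.
  parent-exists : ∀ {v} → v ≢ c → ∃[ p ] (Adj v p × depth v ≡ suc (depth p))
  parent-exists {v} v≢c = firstStep (proj₂ (distance v))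
    where
    firstStep : ∀ {d} → IsDistance graph v c d → ∃[ p ] (Adj v p × d ≡ suc (depth p))
    firstStep ((ε , _) , _) = ⊥-elim (v≢c refl)
    firstStep ((_◅_ {j = p} a w , refl) , min) = p , a , cong suc (≤-antisym shorter (depth≤ w))
      where
      shortest : Σ[ w′ ∈ Walk graph p c ] walkLength graph w′ ≡ depth p
      shortest = proj₁ (proj₂ (distance p))
      shorter : walkLength graph w ≤ depth p
      shorter = ≤-pred (≤-trans (min (a ◅ proj₁ shortest)) (s≤s (≤-reflexive (proj₂ shortest))))

  -- The root is its own parent. This makes ancestors total, with their depth given by truncated
  -- subtraction.
  parent : Fin n → Fin n
  parent v with v Fin.≟ c
  ... | yes _  = c
  ... | no v≢c = proj₁ (parent-exists v≢c)

  parent-adj : ∀ {v} → v ≢ c → Adj v (parent v)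
  parent-adj {v} v≢c with v Fin.≟ c
  ... | yes v≡c = ⊥-elim (v≢c v≡c)
  ... | no v≢c′ = proj₁ (proj₂ (parent-exists v≢c′))

  depth-parent : ∀ {v} → v ≢ c → depth v ≡ suc (depth (parent v))
  depth-parent {v} v≢c with v Fin.≟ c
  ... | yes v≡c = ⊥-elim (v≢c v≡c)
  ... | no v≢c′ = proj₂ (proj₂ (parent-exists v≢c′))

  depth≡0⇒root : ∀ {v} → depth v ≡ 0 → v ≡ c
  depth≡0⇒root {v} d≡0 with v Fin.≟ c
  ... | yes v≡c = v≡c
  ... | no v≢c  = ⊥-elim (1+n≢0 (trans (sym (depth-parent v≢c)) d≡0))

  depth>0⇒≢root : ∀ {v} → depth v > 0 → v ≢ c
  depth>0⇒≢root d>0 refl = <⇒≢ d>0 (sym depth-root)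

  parent-root : parent c ≡ c
  parent-root with c Fin.≟ c
  ... | yes _  = refl
  ... | no c≢c = ⊥-elim (c≢c refl)

  -- The first condition keeps the root from being its own child.
  IsParentOf : Fin n → Fin n → Set
  IsParentOf p v = v ≢ c × parent v ≡ p

  isParentOf? : ∀ p v → Dec (IsParentOf p v)
  isParentOf? p v = ¬? (v Fin.≟ c) ×-dec (parent v Fin.≟ p)

  isParentOf-depth : ∀ {p v} → IsParentOf p v → depth v ≡ suc (depth p)
  isParentOf-depth (v≢c , refl) = depth-parent v≢c

  isParentOf-adj : ∀ {p v} → IsParentOf p v → Adj p v
  isParentOf-adj (v≢c , refl) = symmetric (parent-adj v≢c)

  isParentOf-asym : ∀ {p v} → IsParentOf p v → ¬ IsParentOf v p
  isParentOf-asym pv vp =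
    <-asym (≤-reflexive (sym (isParentOf-depth pv))) (≤-reflexive (sym (isParentOf-depth vp)))

  -- The spanning tree of parent edges, as a graph of its own: a repetition-free path in it is
  -- either a single parent edge or closes a cycle with any edge of the tree joining its ends.
  parentGraph : Graph (Fin n)
  parentGraph = record
    { Adj       = λ u v → IsParentOf u v ⊎ IsParentOf v u
    ; symmetric = ⊎-swap
    ; loopless  = λ { (inj₁ p) → isParentOf-asym p p ; (inj₂ p) → isParentOf-asym p p }
    }

  walkToRoot : ∀ m v → depth v ≡ m → Walk parentGraph v c
  walkToRoot zero v eq with depth≡0⇒root eq
  ... | refl = ε
  walkToRoot (suc m) v eq =
    inj₂ (v≢c , refl) ◅ walkToRoot m (parent v) (suc-injective (trans (sym (depth-parent v≢c)) eq))
    where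
    v≢c : v ≢ c
    v≢c = depth>0⇒≢root (subst (0 <_) (sym eq) z<s)

  reverse : ∀ {u v} → Walk parentGraph u v → Walk parentGraph v u
  reverse ε = ε
  reverse (e ◅ w) = reverse w ◅◅ (⊎-swap e ◅ ε)

  include : ∀ {u v} → Walk parentGraph u v → Walk graph u v
  include ε = ε
  include (inj₁ e ◅ w) = isParentOf-adj e ◅ include w
  include (inj₂ e ◅ w) = symmetric (isParentOf-adj e) ◅ include w

  vertices-include : ∀ {u v} (w : Walk parentGraph u v) →
                     vertices graph (include w) ≡ vertices parentGraph w
  vertices-include ε = refl
  vertices-include (inj₁ e ◅ w) = cong (_ ∷_) (vertices-include w)
  vertices-include (inj₂ e ◅ w) = cong (_ ∷_) (vertices-include w)

  length-include : ∀ {u v} (w : Walk parentGraph u v) →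
                   walkLength graph (include w) ≡ walkLength parentGraph w
  length-include ε = refl
  length-include (inj₁ e ◅ w) = cong suc (length-include w)
  length-include (inj₂ e ◅ w) = cong suc (length-include w)

  -- An edge that is not a parent edge would close a cycle with the path of
  -- parent edges joining its ends.
  adj⇒parent : ∀ {u v} → Adj u v → IsParentOf u v ⊎ IsParentOf v u
  adj⇒parent {u} {v} a with path parentGraph (walkToRoot _ u refl ◅◅ reverse (walkToRoot _ v refl))
  ... | ε , _ = ⊥-elim (loopless a)
  ... | e ◅ ε , _ = e
  ... | w@(_ ◅ _ ◅ _) , uq = ⊥-elim (acyclic
    (u , v , include w , subst Unique (sym (vertices-include w)) uq ,
     ≤-trans (s≤s (s≤s z≤n)) (≤-reflexive (sym (length-include w))) , symmetric a))

  -- Every vertex except the root has exactly one parent, so there are n - 1 parent edges, and each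
  -- adjacency is one of them read upwards or downwards. The added 2 avoids subtraction.
  handshake : sum (map (degree T) (allFin n)) + 2 ≡ n + n
  handshake = begin
    sum (map (degree T) vs) + 2
      ≡⟨ cong (_+ 2) (Sum.⨁-cong vs (λ u → length-filter≡ (adj? u) vs)) ⟩
    Sum.⨁ (λ u → Sum.⨁ (λ v → when (adj? u v) 1) vs) vs + 2
      ≡⟨ cong (_+ 2) (Sum.⨁-cong vs (λ u → trans (Sum.⨁-cong vs (λ v →
           Sum.when-split (adj? u v) (isParentOf? v u) (isParentOf? u v)
             (⊎-swap ∘ adj⇒parent) (symmetric ∘ isParentOf-adj) isParentOf-adj isParentOf-asym 1))
           (Sum.⨁-distrib _ _ vs))) ⟩
    Sum.⨁ (λ u → Sum.⨁ (λ v → when (isParentOf? v u) 1) vs + Sum.⨁ (λ v → when (isParentOf? u v) 1) vs) vs + 2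
      ≡⟨ cong (_+ 2) (Sum.⨁-distrib _ _ vs) ⟩
    up + Sum.⨁ (λ u → Sum.⨁ (λ v → when (isParentOf? u v) 1) vs) vs + 2
      ≡⟨ cong (λ z → up + z + 2) (Sum.⨁-comm (λ u v → when (isParentOf? u v) 1) vs vs) ⟩
    up + up + 2                   ≡⟨ rearr up ⟩
    (up + 1) + (up + 1)           ≡⟨ cong₂ _+_ count count ⟩
    n + n ∎
    where
    open ≡-Reasoning
    open Sum using (when)
    vs = allFin n
    up = Sum.⨁ (λ u → Sum.⨁ (λ v → when (isParentOf? v u) 1) vs) vs
    rearr : ∀ a → a + a + 2 ≡ (a + 1) + (a + 1)
    rearr = solve-∀
    nonroot : ∀ u → Sum.⨁ (λ v → when (isParentOf? v u) 1) vs ≡ when (¬? (u Fin.≟ c)) 1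
    nonroot u with u Fin.≟ c
    ... | yes u≡c = Sum.⨁-const vs
    ... | no u≢c  = count-≡ {n} (proj₁ (parent-exists u≢c))
    count : up + 1 ≡ n
    count = begin
      up + 1
        ≡⟨ cong₂ _+_ (Sum.⨁-cong vs nonroot) (sym (count-≡ c)) ⟩
      Sum.⨁ (λ u → when (¬? (u Fin.≟ c)) 1) vs + Sum.⨁ (λ u → when (c Fin.≟ u) 1) vs
        ≡⟨ Sum.⨁-distrib _ _ vs ⟨
      Sum.⨁ (λ u → when (¬? (u Fin.≟ c)) 1 + when (c Fin.≟ u) 1) vs
        ≡⟨ Sum.⨁-cong vs one ⟩
      Sum.⨁ (λ u → 1) vs
        ≡⟨ length≡sum vs ⟨
      length vs ≡⟨ length-allFin n ⟩
      n ∎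
      where
      one : ∀ u → when (¬? (u Fin.≟ c)) 1 + when (c Fin.≟ u) 1 ≡ 1
      one u with u Fin.≟ c
      ... | yes u≡c = Sum.when-yes (c Fin.≟ u) (sym u≡c)
      ... | no u≢c  = cong suc (Sum.when-no (c Fin.≟ u) (u≢c ∘ sym))

  ancestor : ℕ → Fin n → Fin n
  ancestor zero    v = v
  ancestor (suc m) v = parent (ancestor m v)

  ancestor-+ : ∀ a b v → ancestor a (ancestor b v) ≡ ancestor (a + b) v
  ancestor-+ zero    b v = refl
  ancestor-+ (suc a) b v = cong parent (ancestor-+ a b v)

  depth-parent-∸ : ∀ v → depth (parent v) ≡ depth v ∸ 1
  depth-parent-∸ v = byCases (v Fin.≟ c)
    where
    byCases : Dec (v ≡ c) → depth (parent v) ≡ depth v ∸ 1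
    byCases (yes refl) = trans (cong depth parent-root) (trans depth-root (sym (cong (_∸ 1) depth-root)))
    byCases (no v≢r)   = sym (cong (_∸ 1) (depth-parent v≢r))

  depth-ancestor : ∀ m v → depth (ancestor m v) ≡ depth v ∸ m
  depth-ancestor zero    v = refl
  depth-ancestor (suc m) v = begin
    depth (parent (ancestor m v)) ≡⟨ depth-parent-∸ _ ⟩
    depth (ancestor m v) ∸ 1      ≡⟨ cong (_∸ 1) (depth-ancestor m v) ⟩
    depth v ∸ m ∸ 1               ≡⟨ ∸-+-assoc (depth v) m 1 ⟩
    depth v ∸ (m + 1)             ≡⟨ cong (depth v ∸_) (+-comm m 1) ⟩
    depth v ∸ suc m               ∎
    where open ≡-Reasoning

  within-parent : ∀ v → WithinDistance graph 1 v (parent v)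
  within-parent v = byCases (v Fin.≟ c)
    where
    byCases : Dec (v ≡ c) → WithinDistance graph 1 v (parent v)
    byCases (yes refl) = subst (WithinDistance graph 1 c) (sym parent-root) (within-refl graph)
    byCases (no v≢r)   = parent-adj v≢r ◅ ε , ≤-refl

  within-ancestor : ∀ m v → WithinDistance graph m v (ancestor m v)
  within-ancestor zero    v = within-refl graph
  within-ancestor (suc m) v =
    within-weaken graph (≤-reflexive (+-comm m 1))
      (within-trans graph (within-ancestor m v) (within-parent (ancestor m v)))

-- Internal vertices and distance k-domination

module _ {n : ℕ} (T : FiniteGraph n) where
  open FiniteGraph T

  internal? : ∀ v → Dec (2 ≤ degree T v)
  internal? v = 2 ≤? degree T v

  internalCount : ℕ
  internalCount = length (filter internal? (allFin n))

  two-neighbours : ∀ {u v w} → Adj u v → Adj u w → v ≢ w → 2 ≤ degree T u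
  two-neighbours {u} {v} {w} uv uw v≢w = degree-≥ T {xs = v ∷ w ∷ []} ((v≢w ∷ []) ∷ [] ∷ [])
    λ { (here refl) → uv ; (there (here refl)) → uw }

module DominationBound {n : ℕ} (T : FiniteGraph n) (tree : IsTree (FiniteGraph.graph T)) where
  open FiniteGraph T
  open IsTree tree using () renaming (nonempty to root)
  open Rooted T tree root

  deepest : Fin n
  deepest = argmax depth root (allFin n)

  height : ℕ
  height = depth deepest

  depth≤height : ∀ v → depth v ≤ height
  depth≤height v = lookupAll (f[xs]≤f[argmax] {f = depth} root (allFin n)) (∈-allFin v)

  spine : ℕ → Fin n
  spine i = ancestor i deepest

  depth-spine : ∀ i → depth (spine i) ≡ height ∸ i
  depth-spine i = depth-ancestor i deepest

  -- The spine has one vertex at each depth up to `height`, so comparing `v` with the one at its own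
  -- depth decides membership.
  OnSpine : Fin n → Set
  OnSpine v = spine (height ∸ depth v) ≡ v

  onSpine? : ∀ v → Dec (OnSpine v)
  onSpine? v = spine (height ∸ depth v) Fin.≟ v

  spine-onSpine : ∀ {i} → i ≤ height → OnSpine (spine i)
  spine-onSpine {i} i≤h = cong spine (trans (cong (height ∸_) (depth-spine i)) (m∸[m∸n]≡n i≤h))

  root-onSpine : OnSpine root
  root-onSpine = depth≡0⇒root (trans (depth-spine (height ∸ depth root))
    (trans (cong (λ z → height ∸ (height ∸ z)) depth-root) (n∸n≡0 height)))

  abstract
    labelWithin : ℕ → Fin n → ℕ
    labelWithin m v with onSpine? v
    labelWithin m       v | yes _ = height ∸ depth v
    -- The first argument bounds the climb to the spine. Starting from `depth v` this case never
    -- arises, because the root lies on the spine; 0 is a default.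
    labelWithin zero    v | no _  = 0
    labelWithin (suc m) v | no _  = suc (labelWithin m (parent v))

    -- label v is the distance from the deepest vertex to v.
    label : Fin n → ℕ
    label v = labelWithin (depth v) v

    label-onSpine : ∀ {v} → OnSpine v → label v ≡ height ∸ depth v
    label-onSpine {v} on = go (depth v)
      where
      go : ∀ m → labelWithin m v ≡ height ∸ depth v
      go m with onSpine? v
      go m       | no off = ⊥-elim (off on)
      go zero    | yes _  = refl
      go (suc m) | yes _  = refl

    label-offSpine : ∀ {v} → ¬ OnSpine v → v ≢ root × label v ≡ suc (label (parent v))
    label-offSpine {v} off = v≢r , trans (cong (λ m → labelWithin m v) (depth-parent v≢r)) (go _)
      where
      v≢r : v ≢ root
      v≢r refl = off root-onSpine
      go : ∀ m → labelWithin (suc m) v ≡ suc (labelWithin m (parent v))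
      go m with onSpine? v
      ... | yes on = ⊥-elim (off on)
      ... | no _   = refl

  label-spine : ∀ {i} → i ≤ height → label (spine i) ≡ i
  label-spine {i} i≤h = trans (label-onSpine (spine-onSpine i≤h))
    (trans (cong (height ∸_) (depth-spine i)) (m∸[m∸n]≡n i≤h))

  -- Off the spine the parent is one step nearer to the deepest vertex; on the spine it is the spine
  -- vertex just below.
  label-step : ∀ {v j} → label v ≡ suc j → ∃[ u ] (Adj v u × label u ≡ j)
  label-step {v} {j} eq with onSpine? v
  ... | no off = parent v , parent-adj (proj₁ (label-offSpine off)) ,
                 suc-injective (trans (sym (proj₂ (label-offSpine off))) eq)
  ... | yes on = spine j ,
                 subst (λ z → Adj z (spine j)) (trans (cong spine (sym eq′)) on)
                   (symmetric (parent-adj (depth>0⇒≢root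
                     (subst (0 <_) (sym (depth-spine j)) (m<n⇒0<n∸m j<h))))) ,
                 label-spine (<⇒≤ j<h)
    where
    eq′ : height ∸ depth v ≡ suc j
    eq′ = trans (sym (label-onSpine on)) eq
    j<h : j < height
    j<h = ≤-trans (≤-reflexive (sym eq′)) (m∸n≤m height (depth v))

  -- Climbing from `v` lowers the label until the spine is met, at an index at most `i`; the climb
  -- then continues along the spine. The second equation records the number of steps.
  spine-ancestor : ∀ {i} → i ≤ height → ∀ v → label v ≤ i →
                   ∃[ m ] (ancestor m v ≡ spine i × m + (height ∸ i) ≡ depth v)
  spine-ancestor {i} i≤h v = go (depth v) v refl
    where
    go : ∀ s v → depth v ≡ s → label v ≤ i →
         ∃[ m ] (ancestor m v ≡ spine i × m + (height ∸ i) ≡ depth v)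
    go s v eq l≤i with onSpine? v
    ... | yes on = i ∸ j , trans (cong (ancestor (i ∸ j)) (sym on))
                     (trans (ancestor-+ (i ∸ j) j deepest) (cong spine (m∸n+n≡m j≤i))) ,
                   +-cancelʳ-≡ j _ _ (begin
                     i ∸ j + (height ∸ i) + j  ≡⟨ shuffle (i ∸ j) (height ∸ i) j ⟩
                     (i ∸ j + j) + (height ∸ i) ≡⟨ cong (_+ (height ∸ i)) (m∸n+n≡m j≤i) ⟩
                     i + (height ∸ i)          ≡⟨ m+[n∸m]≡n i≤h ⟩
                     height                    ≡⟨ m+[n∸m]≡n (depth≤height v) ⟨
                     depth v + j               ∎)
      where
      open ≡-Reasoning
      j = height ∸ depth v
      j≤i : j ≤ i
      j≤i = ≤-trans (≤-reflexive (sym (label-onSpine on))) l≤i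
      shuffle : ∀ a b c → a + b + c ≡ (a + c) + b
      shuffle = solve-∀
    go zero v eq l≤i | no off = ⊥-elim (proj₁ (label-offSpine off) (depth≡0⇒root eq))
    go (suc s) v eq l≤i | no off
      with go s (parent v) (suc-injective (trans (sym (depth-parent v≢r)) eq))
              (≤-trans (n≤1+n _) (≤-trans (≤-reflexive (sym (proj₂ (label-offSpine off)))) l≤i))
      where v≢r = proj₁ (label-offSpine off)
    ... | m , anc , eqm = suc m ,
      trans (cong (λ z → ancestor z v) (+-comm 1 m)) (trans (sym (ancestor-+ m 1 v)) anc) ,
      trans (cong suc eqm) (sym (depth-parent (proj₁ (label-offSpine off))))

  -- The climb from `v` to `spine i` takes `depth v` minus `height ∸ i` steps, and no depth exceeds
  -- `height`.
  within-spine : ∀ {i} → i ≤ height → ∀ v → label v ≤ i → WithinDistance graph i v (spine i)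
  within-spine {i} i≤h v l≤i with spine-ancestor i≤h v l≤i
  ... | m , anc , eq = within-weaken graph m≤i
                         (subst (WithinDistance graph m v) anc (within-ancestor m v))
    where
    m≤i : m ≤ i
    m≤i = +-cancelʳ-≤ (height ∸ i) m i (≤-trans (≤-reflexive eq)
            (≤-trans (depth≤height v) (≤-reflexive (sym (m+[n∸m]≡n i≤h)))))

  spine-internal : ∀ {i} → 0 < i → i < height → 2 ≤ degree T (spine i)
  spine-internal {suc i} _ i<h = two-neighbours T (parent-adj (nonroot i<h))
    (symmetric (parent-adj (nonroot (<⇒≤ i<h))))
    λ eq → m≢1+m+n (height ∸ suc (suc i)) {1} (begin
      height ∸ suc (suc i)              ≡⟨ depth-spine (2 + i) ⟨
      depth (spine (2 + i))             ≡⟨ cong depth eq ⟩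
      depth (spine i)                   ≡⟨ depth-spine i ⟩
      height ∸ i                        ≡⟨ +-cancelʳ-≡ i _ _ (trans (m∸n+n≡m (<⇒≤ (<⇒≤ i<h)))
                                             (sym (trans (shuffle _ i) (m∸n+n≡m i<h)))) ⟩
      suc (height ∸ suc (suc i) + 1)    ∎)
    where
    open ≡-Reasoning
    nonroot : ∀ {j} → j < height → spine j ≢ root
    nonroot {j} j<h = depth>0⇒≢root (subst (0 <_) (sym (depth-spine j)) (m<n⇒0<n∸m j<h))
    shuffle : ∀ a b → suc (a + 1) + b ≡ a + suc (suc b)
    shuffle = solve-∀

  -- The walk follows falling labels. Its last vertex has a neighbour of larger label, where the
  -- walk came from, and one of smaller label, as its own is positive; hence it is internal.
  descend : ∀ s {v t} → label v ≡ suc s + suc t →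
            ∃[ u ] (WithinDistance graph (suc s) v u × label u ≡ suc t × 2 ≤ degree T u)
  descend zero {v} {t} eq with label-step eq
  ... | u , vu , lu with label-step lu
  ... | w , uw , lw = u , (vu ◅ ε , ≤-refl) , lu ,
    two-neighbours T (symmetric vu) uw λ { refl → m≢1+m+n t {1} (trans (sym lw) (trans eq (cong suc (+-comm 1 t)))) }
  descend (suc s) eq with label-step eq
  ... | u , vu , lu with descend s lu
  ... | x , (w , p) , lx , dx = x , (vu ◅ w , s≤s p) , lx , dx

  module _ (k γ : ℕ) .{{_ : NonZero k}} (γ≥2 : γ ≥ 2) (dom : IsDistanceDominationNumber T k γ) where

    -- Otherwise the root alone would dominate.
    k<height : k < height
    k<height with k <? height
    ... | yes k<h = k<h
    ... | no k≮h  = ⊥-elim (<⇒≱ γ≥2 (covering-list-length T dom (root ∷ []) λ v →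
      root , here refl , within-depth v))
      where
      within-depth : ∀ v → WithinDistance graph k v root
      within-depth v = proj₁ (proj₁ (proj₂ (distance v))) ,
        ≤-trans (≤-reflexive (proj₂ (proj₁ (proj₂ (distance v)))))
                (≤-trans (depth≤height v) (≮⇒≥ k≮h))

    -- The shift by one puts the labels 1, ..., k into the classes 0, ..., k - 1.
    class : Fin n → Fin k
    class v = pred (label v) mod k

    toℕ-class : ∀ v → toℕ (class v) ≡ pred (label v) % k
    toℕ-class v = Fin.toℕ-fromℕ< (m%n<n (pred (label v)) k)

    level? : ∀ (ι : Fin k) v → Dec (2 ≤ degree T v × class v ≡ ι)
    level? ι v = internal? T v ×-dec (class v Fin.≟ ι)

    level-dominates : ∀ ι v → ∃[ u ] (u ∈ filter (level? ι) (allFin n) × WithinDistance graph k v u)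
    level-dominates ι v with label v ≤? suc (toℕ ι)
    -- Small labels: the spine vertex labelled `i` has the right class, is internal because i ≤ k <
    -- height, and lies within `i` of `v`.
    ... | yes l≤i =
      spine i , ∈-filter⁺ (level? ι) (∈-allFin _) (spine-internal z<s i<h , Fin.toℕ-injective (begin
        toℕ (class (spine i))        ≡⟨ toℕ-class (spine i) ⟩
        pred (label (spine i)) % k   ≡⟨ cong (λ z → pred z % k) (label-spine (<⇒≤ i<h)) ⟩
        toℕ ι % k                    ≡⟨ m<n⇒m%n≡m (Fin.toℕ<n ι) ⟩
        toℕ ι                        ∎)) ,
      within-weaken graph (Fin.toℕ<n ι) (within-spine (<⇒≤ i<h) v l≤i)
      where
      open ≡-Reasoning
      i = suc (toℕ ι)
      i<h : i < height
      i<h = ≤-trans (s≤s (Fin.toℕ<n ι)) k<height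
    ... | no l≰i = conclude (descend (e % k) split)
      where
      open ≡-Reasoning
      -- Large labels: `suc (e % k)` steps, at most k, bring the label down to `suc (toℕ ι)` plus a
      -- multiple of k.
      e = label v ∸ suc (suc (toℕ ι))
      shuffle : ∀ r a b → suc (suc a) + (r + b) ≡ suc r + suc (a + b)
      shuffle = solve-∀
      split : label v ≡ suc (e % k) + suc (toℕ ι + (e / k) * k)
      split = begin
        label v                                    ≡⟨ m+[n∸m]≡n (≰⇒> l≰i) ⟨
        suc (suc (toℕ ι)) + e                      ≡⟨ cong (suc (suc (toℕ ι)) +_) (m≡m%n+[m/n]*n e k) ⟩
        suc (suc (toℕ ι)) + (e % k + (e / k) * k)  ≡⟨ shuffle (e % k) (toℕ ι) _ ⟩
        suc (e % k) + suc (toℕ ι + (e / k) * k)    ∎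
      conclude : ∃[ u ] (WithinDistance graph (suc (e % k)) v u ×
                         label u ≡ suc (toℕ ι + (e / k) * k) × 2 ≤ degree T u) →
                 ∃[ u ] (u ∈ filter (level? ι) (allFin n) × WithinDistance graph k v u)
      conclude (u , near , lu , du) =
        u , ∈-filter⁺ (level? ι) (∈-allFin u) (du , Fin.toℕ-injective (begin
          toℕ (class u)                 ≡⟨ toℕ-class u ⟩
          pred (label u) % k            ≡⟨ cong (λ z → pred z % k) lu ⟩
          (toℕ ι + (e / k) * k) % k     ≡⟨ [m+kn]%n≡m%n (toℕ ι) (e / k) k ⟩
          toℕ ι % k                     ≡⟨ m<n⇒m%n≡m (Fin.toℕ<n ι) ⟩
          toℕ ι                         ∎)) ,
        within-weaken graph (m%n<n e k) near

    -- Each of the k classes of internal vertices dominates and so has at least γ members, and every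
    -- internal vertex lies in exactly one class.
    k*γ≤internalCount : k * γ ≤ internalCount T
    k*γ≤internalCount = begin
      k * γ                                            ≡⟨ cong (_* γ) (length-allFin k) ⟨
      length (allFin k) * γ                            ≤⟨ sum-≥ (allFin k) ⟩
      Sum.⨁ (λ ι → length (filter (level? ι) vs)) (allFin k)
        ≡⟨ Sum.⨁-cong (allFin k) (λ ι → length-filter≡ (level? ι) vs) ⟩
      Sum.⨁ (λ ι → Sum.⨁ (λ v → Sum.when (level? ι v) 1) vs) (allFin k)
        ≡⟨ Sum.⨁-comm (λ ι v → Sum.when (level? ι v) 1) (allFin k) vs ⟩
      Sum.⨁ (λ v → Sum.⨁ (λ ι → Sum.when (level? ι v) 1) (allFin k)) vs
        ≡⟨ Sum.⨁-cong vs once ⟩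
      Sum.⨁ (λ v → Sum.when (internal? T v) 1) vs   ≡⟨ length-filter≡ (internal? T) vs ⟨
      internalCount T                                  ∎
      where
      open ≤-Reasoning
      vs = allFin n
      sum-≥ : ∀ ιs → length ιs * γ ≤ Sum.⨁ (λ ι → length (filter (level? ι) vs)) ιs
      sum-≥ [] = z≤n
      sum-≥ (ι ∷ ιs) = +-mono-≤ (covering-list-length T dom _ (level-dominates ι)) (sum-≥ ιs)
      once : ∀ v → Sum.⨁ (λ ι → Sum.when (level? ι v) 1) (allFin k) ≡ Sum.when (internal? T v) 1
      once v with does (internal? T v)
      ... | false = Sum.⨁-const (allFin k)
      ... | true  = count-≡ {k} (class v)

-- Products of functions of the degrees

*-swap : ∀ a b c → a * (b * c) ≡ b * (a * c)
*-swap = solve-∀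

module DegreeCounts {V : Set} (d : V → ℕ) where

  twoPlus : List V → ℕ
  twoPlus vs = length (filter (λ v → 2 ≤? d v) vs)

  excess : List V → ℕ
  excess vs = sum (map (λ v → d v ∸ 2) vs)

  -- A positive degree is 1, plus 1 if it is at least 2, plus its excess over 2.
  sum-degrees : ∀ {vs} → All (λ v → 1 ≤ d v) vs → sum (map d vs) ≡ length vs + twoPlus vs + excess vs
  sum-degrees [] = refl
  sum-degrees {v ∷ vs} (pos ∷ poss) with d v | sum-degrees poss
  ... | suc zero    | ih = cong suc ih
  ... | suc (suc x) | ih = trans (cong (suc (suc x) +_) ih) (shuffle x (length vs) (twoPlus vs) (excess vs))
    where
    shuffle : ∀ x a b c → suc (suc x) + (a + b + c) ≡ suc a + suc b + (x + c)
    shuffle = solve-∀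

  excess≡0⇒≤2 : ∀ vs → excess vs ≡ 0 → ∀ {v} → v ∈ vs → d v ≤ 2
  excess≡0⇒≤2 (v ∷ vs) eq (here refl) = m∸n≡0⇒m≤n (m+n≡0⇒m≡0 (d v ∸ 2) eq)
  excess≡0⇒≤2 (v ∷ vs) eq (there v∈)  = excess≡0⇒≤2 vs (m+n≡0⇒n≡0 (d v ∸ 2) eq) v∈

  excess>0⇒≥3 : ∀ vs → excess vs > 0 → ∃[ v ] (v ∈ vs × 3 ≤ d v)
  excess>0⇒≥3 (v ∷ vs) pos with d v in eq
  ... | suc (suc (suc x)) = v , here refl , ≤-trans (s≤s (s≤s (s≤s z≤n))) (≤-reflexive (sym eq))
  ... | 0 = let u , u∈ , p = excess>0⇒≥3 vs pos in u , there u∈ , p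
  ... | 1 = let u , u∈ , p = excess>0⇒≥3 vs pos in u , there u∈ , p
  ... | 2 = let u , u∈ , p = excess>0⇒≥3 vs pos in u , there u∈ , p

  -- All the excess sits at `c`. Paths are covered too: with excess 0, `c` is any vertex of degree
  -- 2.
  Spike : List V → Set
  Spike vs = ∃[ c ] (d c ≡ 2 + excess vs × (∀ {v} → v ∈ vs → v ≢ c → d v ≤ 2))

  TwoBranching : Set
  TwoBranching = ∃[ u ] ∃[ v ] (u ≢ v × 3 ≤ d u × 3 ≤ d v)

-- Instantiated with _<_ and _>_: merging two excess degrees into one vertex,
-- or adding excess degree at the cost of a vertex of degree 2, moves the
-- product of the weights strictly in the direction of _≺_.
module ExtremalProduct
  (_≺_ : ℕ → ℕ → Set)
  (≺-trans : ∀ {a b c} → a ≺ b → b ≺ c → a ≺ c)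
  (*-mono-≺ : ∀ c {a b} → a ≺ b → (suc c * a) ≺ (suc c * b))
  (*-cancel-≺ : ∀ c {a b} → (suc c * a) ≺ (suc c * b) → a ≺ b)
  (weight : ℕ → ℕ)
  (weight-1 : weight 1 ≡ 1)
  (weight-2 : weight 2 ≡ 4)
  (weight>0 : ∀ x → weight (2 + x) > 0)
  (merge : ∀ x y → (weight (3 + x) * weight (3 + y)) ≺ (4 * weight (2 + (suc x + suc y))))
  (grow : ∀ x → (4 * weight (2 + x)) ≺ weight (3 + x))
  where

  private
    *-mono-≺′ : ∀ {c a b} → c > 0 → a ≺ b → (c * a) ≺ (c * b)
    *-mono-≺′ {suc c} _ = *-mono-≺ c

    4^>0 : ∀ i → 4 ^ i > 0
    4^>0 i = m^n>0 4 i

    ≺-resp : ∀ {a b c e} → a ≡ b → c ≡ e → a ≺ c → b ≺ e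
    ≺-resp refl refl p = p

  module _ {V : Set} (d : V → ℕ) where
    open DegreeCounts d

    weights : List V → ℕ
    weights vs = product (map (weight ∘ d) vs)

    -- The best arrangement has one degree 2 + X, with X the total excess, and 2 for the other
    -- internal vertices. The factor 4, the weight of 2, replaces an exponent `twoPlus vs ∸ 1`; for
    -- lists without internal vertices `twoPlus vs ≡ 0` takes the place of the spike.
    Outcome : List V → Set
    Outcome vs =
      (4 * weights vs ≡ 4 ^ twoPlus vs * weight (2 + excess vs) × (twoPlus vs ≡ 0 ⊎ Spike vs)) ⊎
      ((4 * weights vs) ≺ (4 ^ twoPlus vs * weight (2 + excess vs)) × TwoBranching)

    twoPlus≡0⇒excess≡0 : ∀ vs → twoPlus vs ≡ 0 → excess vs ≡ 0
    twoPlus≡0⇒excess≡0 [] _ = refl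
    twoPlus≡0⇒excess≡0 (v ∷ vs) eq with d v
    ... | 0 = twoPlus≡0⇒excess≡0 vs eq
    ... | 1 = twoPlus≡0⇒excess≡0 vs eq

    merge-equal : ∀ {x y} → x ≡ 0 ⊎ y ≡ 0 → weight (2 + x) * weight (2 + y) ≡ 4 * weight (2 + (x + y))
    merge-equal {y = y} (inj₁ refl) = cong (_* weight (2 + y)) weight-2
    merge-equal {x} (inj₂ refl) = trans (*-comm (weight (2 + x)) _)
      (cong₂ (λ a b → a * weight (2 + b)) weight-2 (sym (+-identityʳ x)))

    merge-weak : ∀ x y → (x ≡ 0 ⊎ y ≡ 0) ⊎
                         (0 < x × 0 < y × (weight (2 + x) * weight (2 + y)) ≺ (4 * weight (2 + (x + y))))
    merge-weak zero    y       = inj₁ (inj₁ refl)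
    merge-weak (suc x) zero    = inj₁ (inj₂ refl)
    merge-weak (suc x) (suc y) = inj₂ (z<s , z<s , merge x y)

    -- Vertices are added one at a time: degree 1 contributes the factor 1, and degree 2 + x has its
    -- excess merged with the excess collected so far, strictly unless one of the two is 0.
    outcome : ∀ vs → Unique vs → All (λ v → 1 ≤ d v) vs → Outcome vs
    outcome [] _ _ = inj₁ (sym (trans (*-identityˡ _) weight-2) , inj₁ refl)
    outcome (v ∷ vs) (v∉ ∷ uniq) (pos ∷ poss) with d v in eq
    ... | suc zero = one (outcome vs uniq poss)
      where
      same : 4 * weights vs ≡ 4 * (weight 1 * weights vs)
      same = cong (4 *_) (sym (trans (cong (_* weights vs) weight-1) (*-identityˡ _)))
      one : Outcome vs → _
      one (inj₁ (e , inj₁ i≡0)) = inj₁ (trans (sym same) e , inj₁ i≡0)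
      one (inj₁ (e , inj₂ (c , dc , rest))) = inj₁ (trans (sym same) e , inj₂ (c , dc ,
        λ { (here refl) _ → ≤-trans (≤-reflexive eq) (s≤s z≤n) ; (there v∈) → rest v∈ }))
      one (inj₂ (p , two)) = inj₂ (≺-resp same refl p , two)
    ... | suc (suc x) = more (outcome vs uniq poss)
      where
      i = twoPlus vs
      y = excess vs
      before : weight (2 + x) * (4 * weights vs) ≡ 4 * (weight (2 + x) * weights vs)
      before = *-swap (weight (2 + x)) 4 (weights vs)
      after : weight (2 + x) * (4 ^ i * weight (2 + y)) ≡ 4 ^ i * (weight (2 + x) * weight (2 + y))
      after = *-swap (weight (2 + x)) (4 ^ i) (weight (2 + y))
      fuse : 4 ^ i * (4 * weight (2 + (x + y))) ≡ 4 ^ suc i * weight (2 + (x + y))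
      fuse = trans (*-swap (4 ^ i) 4 _) (sym (*-assoc 4 (4 ^ i) _))
      newSpike : y ≡ 0 → ∃[ c ] (d c ≡ 2 + (x + y) × (∀ {u} → u ∈ v ∷ vs → u ≢ c → d u ≤ 2))
      newSpike y≡0 = v , trans eq (cong (2 +_) (trans (sym (+-identityʳ x)) (cong (x +_) (sym y≡0)))) ,
        λ { (here refl) ne → ⊥-elim (ne refl) ; (there u∈) _ → excess≡0⇒≤2 vs y≡0 u∈ }
      spike : x ≡ 0 ⊎ y ≡ 0 → i ≡ 0 ⊎ Spike vs →
              ∃[ c ] (d c ≡ 2 + (x + y) × (∀ {u} → u ∈ v ∷ vs → u ≢ c → d u ≤ 2))
      spike (inj₂ y≡0) _ = newSpike y≡0
      spike (inj₁ _) (inj₁ i≡0) = newSpike (twoPlus≡0⇒excess≡0 vs i≡0)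
      spike (inj₁ refl) (inj₂ (c , dc , rest)) = c , dc ,
        λ { (here refl) _ → ≤-reflexive eq ; (there u∈) → rest u∈ }
      two-branching : 0 < x → 0 < y → TwoBranching
      two-branching 0<x 0<y with excess>0⇒≥3 vs 0<y
      ... | u , u∈ , p = v , u , lookupAll v∉ u∈ ,
                         ≤-trans (s≤s (s≤s 0<x)) (≤-reflexive (sym eq)) , p
      more : Outcome vs → _
      more (inj₁ (e , s)) with merge-weak x y
      ... | inj₁ z = inj₁ (trans (sym before) (trans (cong (weight (2 + x) *_) e)
                       (trans after (trans (cong (4 ^ i *_) (merge-equal z)) fuse))) ,
                       inj₂ (spike z s))
      ... | inj₂ (0<x , 0<y , p) = inj₂
            (≺-resp (sym (trans (sym before) (trans (cong (weight (2 + x) *_) e) after))) fuse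
              (*-mono-≺′ (4^>0 i) p) , two-branching 0<x 0<y)
      more (inj₂ (q , two)) with merge-weak x y
      ... | inj₁ z = inj₂ (≺-resp before (trans after (trans (cong (4 ^ i *_) (merge-equal z)) fuse))
                       (*-mono-≺′ (weight>0 x) q) , two)
      ... | inj₂ (0<x , 0<y , p) = inj₂
            (≺-trans (≺-resp before after (*-mono-≺′ (weight>0 x) q))
                     (≺-resp refl fuse (*-mono-≺′ (4^>0 i) p)) , two)

    -- Iterating `grow` trades `t` vertices of degree 2 for `t` units of excess; only t = 0 is
    -- neutral.
    grow-by : ∀ t x → (t ≡ 0) ⊎ (0 < t × (4 ^ t * weight (2 + x)) ≺ weight (2 + (x + t)))
    grow-by zero x = inj₁ refl
    grow-by (suc t) x with grow-by t x
    ... | inj₁ refl = inj₂ (z<s , ≺-resp (sym (cong (_* weight (2 + x)) (*-identityʳ 4)))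
                        (cong (λ z → weight (2 + z)) (sym (+-comm x 1))) (grow x))
    ... | inj₂ (_ , p) = inj₂ (z<s , ≺-trans (≺-resp (sym (*-assoc 4 (4 ^ t) _)) refl (*-mono-≺ 3 p))
                     (≺-resp refl (cong (λ z → weight (2 + z)) (sym (+-suc x t))) (grow (x + t))))

    -- Here `suc p` is the required number of internal vertices and `t` the surplus. The strict case
    -- records its cause, which later excludes an isomorphism with the extremal tree.
    Extremal : List V → ℕ → ℕ → Set
    Extremal vs p t =
      (weights vs ≡ 4 ^ p * weight (2 + (excess vs + t)) × t ≡ 0 × Spike vs) ⊎
      (weights vs ≺ (4 ^ p * weight (2 + (excess vs + t))) × (TwoBranching ⊎ 0 < t × Spike vs))

    extremal : ∀ {vs p t} → Unique vs → All (λ v → 1 ≤ d v) vs → twoPlus vs ≡ suc p + t → Extremal vs p t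
    extremal {vs} {p} {t} uniq pos i≡ = combine (outcome vs uniq pos) (grow-by t x)
      where
      x = excess vs
      split : 4 ^ twoPlus vs * weight (2 + x) ≡ 4 * (4 ^ p * (4 ^ t * weight (2 + x)))
      split = trans (cong (λ z → 4 ^ z * weight (2 + x)) i≡)
        (trans (cong (_* weight (2 + x)) (^-distribˡ-+-* 4 (suc p) t))
          (trans (cong (_* weight (2 + x)) (*-assoc 4 (4 ^ p) (4 ^ t)))
            (trans (*-assoc 4 (4 ^ p * 4 ^ t) (weight (2 + x))) (cong (4 *_) (*-assoc (4 ^ p) (4 ^ t) _)))))
      nospike : twoPlus vs ≡ 0 ⊎ Spike vs → Spike vs
      nospike (inj₁ i≡0) = ⊥-elim (1+n≢0 (trans (sym i≡) i≡0))
      nospike (inj₂ s)   = s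
      flat : t ≡ 0 → 4 ^ p * (4 ^ t * weight (2 + x)) ≡ 4 ^ p * weight (2 + (x + t))
      flat refl = cong (4 ^ p *_) (trans (*-identityˡ _) (cong (λ z → weight (2 + z)) (sym (+-identityʳ x))))
      combine : Outcome vs → t ≡ 0 ⊎ (0 < t × (4 ^ t * weight (2 + x)) ≺ weight (2 + (x + t))) → Extremal vs p t
      combine (inj₁ (e , s)) (inj₁ t≡0) =
        inj₁ (trans (*-cancelˡ-≡ _ _ 4 (trans e split)) (flat t≡0) , t≡0 , nospike s)
      combine (inj₁ (e , s)) (inj₂ (0<t , q)) = inj₂
        (≺-resp (sym (*-cancelˡ-≡ _ _ 4 (trans e split))) refl (*-mono-≺′ (4^>0 p) q) , inj₂ (0<t , nospike s))
      combine (inj₂ (q , two)) (inj₁ t≡0) =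
        inj₂ (≺-resp refl (flat t≡0) (*-cancel-≺ 3 (≺-resp refl split q)) , inj₁ two)
      combine (inj₂ (q , two)) (inj₂ (_ , r)) =
        inj₂ (≺-trans (*-cancel-≺ 3 (≺-resp refl split q)) (*-mono-≺′ (4^>0 p) r) , inj₁ two)

-- Inequalities for self-powers and squares

-- (M + 1)ʲ ≤ Mʲ + j (M + 1)ʲ⁻¹, multiplied by M + 1 so that no exponent is subtracted.
bernoulli : ∀ M j → suc M * suc M ^ j ≤ suc M * M ^ j + j * suc M ^ j
bernoulli M zero    = m≤m+n _ 0
bernoulli M (suc j) = begin
  suc M * (suc M * suc M ^ j)                    ≤⟨ *-monoʳ-≤ (suc M) (bernoulli M j) ⟩
  suc M * (suc M * M ^ j + j * suc M ^ j)        ≡⟨ shuffle₁ M (M ^ j) (suc M ^ j) j ⟩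
  suc M * M * M ^ j + suc M * M ^ j + j * (suc M * suc M ^ j)
    ≤⟨ +-monoˡ-≤ (j * (suc M * suc M ^ j)) (+-monoʳ-≤ (suc M * M * M ^ j) (*-monoʳ-≤ (suc M) (^-monoˡ-≤ j (n≤1+n M)))) ⟩
  suc M * M * M ^ j + suc M * suc M ^ j + j * (suc M * suc M ^ j)
    ≡⟨ shuffle₂ M (M ^ j) (suc M ^ j) j ⟩
  suc M * (M * M ^ j) + suc j * (suc M * suc M ^ j) ∎
  where
  open ≤-Reasoning
  shuffle₁ : ∀ M a b j → suc M * (suc M * a + j * b) ≡ suc M * M * a + suc M * a + j * (suc M * b)
  shuffle₁ = solve-∀
  shuffle₂ : ∀ M a b j → suc M * M * a + suc M * b + j * (suc M * b) ≡ suc M * (M * a) + suc j * (suc M * b)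
  shuffle₂ = solve-∀

*-cancelˡ-<′ : ∀ c {a b} → c * a < c * b → a < b
*-cancelˡ-<′ c {a} {b} = *-cancelˡ-< c a b

-- Strict log-convexity: for positive `h`, the ratios of successive values increase. Everything is
-- written without division.
module LogConvex (h : ℕ → ℕ)
                 (convex : ∀ a → h (1 + a) * h (1 + a) < h a * h (2 + a)) where

  private
    -- Transitivity of ratios: c/e < b/a and b/a < g/f, with the common factor `a * b` cancelled
    -- after multiplying.
    chain : ∀ a b c e f g → c * a < e * b → f * b < a * g → c * f < e * g
    chain a b c e f g p q = *-cancelˡ-<′ (a * b) (begin-strict
      a * b * (c * f)       ≡⟨ shuffle₁ a b c f ⟩
      (c * a) * (f * b)     <⟨ *-mono-< p q ⟩
      (e * b) * (a * g)     ≡⟨ shuffle₂ a b e g ⟩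
      a * b * (e * g)       ∎)
      where
      open ≤-Reasoning
      shuffle₁ : ∀ a b c f → a * b * (c * f) ≡ (c * a) * (f * b)
      shuffle₁ = solve-∀
      shuffle₂ : ∀ a b e g → (e * b) * (a * g) ≡ a * b * (e * g)
      shuffle₂ = solve-∀

  convex-gap : ∀ a t → h (1 + a) * h (1 + a + t) < h a * h (2 + a + t)
  convex-gap a zero rewrite +-identityʳ a = convex a
  convex-gap a (suc t) rewrite +-suc a t =
    chain (h (1 + a + t)) (h (2 + a + t)) (h (1 + a)) (h a) (h (2 + a + t)) (h (3 + a + t))
      (convex-gap a t) (convex (1 + a + t))

  -- Two arguments are spread apart, keeping their sum, until the smaller is `a`; the induction
  -- moves one unit at a time and compares ratios by `convex-gap`.
  convex-merge : ∀ a s t → h (1 + a + s) * h (1 + a + t) < h a * h (2 + a + (s + t))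
  convex-merge a zero t rewrite +-identityʳ a = convex-gap a t
  convex-merge a (suc s) t = subst₂ (λ u v → h u * h (1 + a + t) < h a * h v) (eq₁ a s) (eq₂ a s t)
    (subst (_< h a * h (3 + a + (s + t))) (*-comm (h (1 + a + t)) (h (2 + a + s)))
      (chain (h (1 + a + s)) (h (2 + a + (s + t))) (h (1 + a + t)) (h a) (h (2 + a + s)) (h (3 + a + (s + t)))
        (subst (_< h a * h (2 + a + (s + t))) (*-comm (h (1 + a + s)) (h (1 + a + t))) (convex-merge a s t))
        (subst (λ z → h (2 + a + s) * h z < h (1 + a + s) * h (suc z)) (eq₃ a s t)
          (convex-gap (1 + a + s) t))))
    where
    eq₁ : ∀ a s → 2 + a + s ≡ 1 + a + suc s
    eq₁ = solve-∀
    eq₂ : ∀ a s t → 3 + a + (s + t) ≡ 2 + a + (suc s + t)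
    eq₂ = solve-∀
    eq₃ : ∀ a s t → 2 + a + s + t ≡ 2 + a + (s + t)
    eq₃ = solve-∀

^-distribʳ-* : ∀ a m n → (m * n) ^ a ≡ m ^ a * n ^ a
^-distribʳ-* zero    m n = refl
^-distribʳ-* (suc a) m n = trans (cong (m * n *_) (^-distribʳ-* a m n)) (eq m n (m ^ a) (n ^ a))
  where
  eq : ∀ m n x y → m * n * (x * y) ≡ m * x * (n * y)
  eq = solve-∀

-- With M = a (a + 2) and M + 1 = (a + 1)², the left side is (M + 1)ᵃ⁺¹ and the right side is (a +
-- 2)² Mᵃ. By `bernoulli`, (a² + a + 1) (M + 1)ᵃ ≤ (M + 1) Mᵃ, and (M + 1)² < (a + 2)² (a² + a + 1)
-- does the rest.
self-power-convex : ∀ a → (1 + a) ^ (1 + a) * (1 + a) ^ (1 + a) < a ^ a * (2 + a) ^ (2 + a)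
self-power-convex a = subst₂ _<_ square other (*-cancelˡ-<′ (suc M) (begin-strict
  suc M * (suc M * P)                       ≡⟨ *-assoc (suc M) (suc M) P ⟨
  suc M * suc M * P                         <⟨ *-monoˡ-< P room ⟩
  (2 + a) * (2 + a) * (a * a + a + 1) * P   ≡⟨ *-assoc ((2 + a) * (2 + a)) (a * a + a + 1) P ⟩
  (2 + a) * (2 + a) * ((a * a + a + 1) * P) ≤⟨ *-monoʳ-≤ ((2 + a) * (2 + a)) bound ⟩
  (2 + a) * (2 + a) * (suc M * Q)           ≡⟨ *-swap ((2 + a) * (2 + a)) (suc M) Q ⟩
  suc M * ((2 + a) * (2 + a) * Q)           ∎))
  where
  open ≤-Reasoning
  M = a * (2 + a)
  P = suc M ^ a
  Q = M ^ a
  instance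
    P≢0 : NonZero P
    P≢0 = m^n≢0 (suc M) a
  bound : (a * a + a + 1) * P ≤ suc M * Q
  bound = +-cancelʳ-≤ (a * P) ((a * a + a + 1) * P) (suc M * Q) (≤-trans (≤-reflexive (eq a P)) (bernoulli M a))
    where
    eq : ∀ a P → (a * a + a + 1) * P + a * P ≡ suc (a * (2 + a)) * P
    eq = solve-∀
  room : suc M * suc M < (2 + a) * (2 + a) * (a * a + a + 1)
  room = ≤-trans (s≤s (m≤m+n _ _)) (≤-reflexive (eq a))
    where
    eq : ∀ a → suc (suc (a * (2 + a)) * suc (a * (2 + a)) + (a * a * a + 3 * (a * a) + 4 * a + 2))
               ≡ (2 + a) * (2 + a) * (a * a + a + 1)
    eq = solve-∀
  square : suc M * P ≡ (1 + a) ^ (1 + a) * (1 + a) ^ (1 + a)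
  square = trans (cong (_^ suc a) (sq a)) (^-distribʳ-* (suc a) (suc a) (suc a))
    where
    sq : ∀ a → suc (a * (2 + a)) ≡ suc a * suc a
    sq = solve-∀
  other : (2 + a) * (2 + a) * Q ≡ a ^ a * (2 + a) ^ (2 + a)
  other = trans (cong ((2 + a) * (2 + a) *_) (^-distribʳ-* a a (2 + a))) (eq (2 + a) (a ^ a) ((2 + a) ^ a))
    where
    eq : ∀ b x y → b * b * (x * y) ≡ x * (b * (b * y))
    eq = solve-∀

self-power>0 : ∀ a → 0 < a ^ a
self-power>0 zero    = z<s
self-power>0 (suc a) = m^n>0 (suc a) (suc a)

self-power-merge : ∀ x y → (3 + x) ^ (3 + x) * (3 + y) ^ (3 + y) <
                           4 * (2 + (suc x + suc y)) ^ (2 + (suc x + suc y))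
self-power-merge x y = subst (λ z → (3 + x) ^ (3 + x) * (3 + y) ^ (3 + y) < 4 * z ^ z) (eq x y)
  -- The smaller argument is lowered to 2, whose self-power is the factor 4.
  (LogConvex.convex-merge (λ a → a ^ a) self-power-convex 2 x y)
  where
  eq : ∀ x y → 4 + (x + y) ≡ 2 + (suc x + suc y)
  eq = solve-∀

self-power-grow : ∀ x → 4 * (2 + x) ^ (2 + x) < (3 + x) ^ (3 + x)
-- This is 16 < 27.
self-power-grow zero    = m≤m+n 17 10
self-power-grow (suc x) = begin-strict
  4 * (3 + x) ^ (3 + x)         <⟨ *-monoʳ-< 4 (^-monoˡ-< (3 + x) (n<1+n (3 + x))) ⟩
  4 * (4 + x) ^ (3 + x)         ≤⟨ *-monoˡ-≤ ((4 + x) ^ (3 + x)) (m≤m+n 4 x) ⟩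
  (4 + x) * (4 + x) ^ (3 + x)   ∎
  where open ≤-Reasoning

-- Squares of 2 (4 + x + y) < (3 + x) (3 + y), where the difference is 1 + x + y + x y.
square-merge : ∀ x y → 4 * (2 + (suc x + suc y)) ^ 2 < (3 + x) ^ 2 * (3 + y) ^ 2
square-merge x y = subst₂ _<_ (eq₁ x y) (^-distribʳ-* 2 (3 + x) (3 + y))
  (^-monoˡ-< 2 {2 * (4 + x + y)} (≤-trans (s≤s (m≤m+n _ (x + y + x * y))) (≤-reflexive (eq₂ x y))))
  where
  eq₁ : ∀ x y → (2 * (4 + x + y)) * ((2 * (4 + x + y)) * 1) ≡
                4 * ((2 + (suc x + suc y)) * ((2 + (suc x + suc y)) * 1))
  eq₁ = solve-∀
  eq₂ : ∀ x y → suc (2 * (4 + x + y) + (x + y + x * y)) ≡ (3 + x) * (3 + y)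
  eq₂ = solve-∀

square-grow : ∀ x → (3 + x) ^ 2 < 4 * (2 + x) ^ 2
square-grow x = ≤-trans (s≤s (m≤m+n _ _)) (≤-reflexive (eq x))
  where
  eq : ∀ x → suc ((3 + x) * ((3 + x) * 1) + (6 + 10 * x + 3 * (x * x))) ≡ 4 * ((2 + x) * ((2 + x) * 1))
  eq = solve-∀

module SquareProduct = ExtremalProduct _>_ (λ p q → <-trans q p) (λ c → *-monoʳ-< (suc c))
  (λ c → *-cancelˡ-<′ (suc c)) (_^ 2) refl refl (λ x → m^n>0 (2 + x) 2) square-merge square-grow

module SelfPowerProduct = ExtremalProduct _<_ <-trans (λ c → *-monoʳ-< (suc c))
  (λ c → *-cancelˡ-<′ (suc c)) (λ a → a ^ a) refl refl (λ x → self-power>0 (2 + x)) self-power-merge self-power-grow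

-- Starlike trees

≅-trans : {U V W : Set} {G : Graph U} {H : Graph V} {K : Graph W} → G ≅ H → H ≅ K → G ≅ K
≅-trans (f , p) (g , q) =
  mk↔ₛ′ (Inverse.to g ∘ Inverse.to f) (Inverse.from f ∘ Inverse.from g)
    (λ x → trans (cong (Inverse.to g) (Inverse.strictlyInverseˡ f _)) (Inverse.strictlyInverseˡ g x))
    (λ x → trans (cong (Inverse.from f) (Inverse.strictlyInverseʳ g _)) (Inverse.strictlyInverseʳ f x)) ,
  λ u v → mk⇔ (Equivalence.to (q _ _) ∘ Equivalence.to (p u v))
              (Equivalence.from (p u v) ∘ Equivalence.from (q _ _))

embedding⇒≅ : {V W : Set} (G : Graph V) (H : Graph W) (f : W → V) →
              (∀ {x y} → f x ≡ f y → x ≡ y) → (∀ v → ∃[ x ] f x ≡ v) →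
              (∀ x y → Graph.Adj H x y ⇔ Graph.Adj G (f x) (f y)) → G ≅ H
embedding⇒≅ G H f inj surj adj =
  mk↔ₛ′ (proj₁ ∘ surj) f (λ x → inj (proj₂ (surj (f x)))) (proj₂ ∘ surj) ,
  λ u v → mk⇔
    (λ a → Equivalence.from (adj _ _) (subst₂ (Graph.Adj G) (sym (proj₂ (surj u))) (sym (proj₂ (surj v))) a))
    (λ a → subst₂ (Graph.Adj G) (proj₂ (surj u)) (proj₂ (surj v)) (Equivalence.to (adj _ _) a))

lookup-map : {A B : Set} (f : A → B) (xs : List A) (i : Fin (length (map f xs))) →
             lookup (map f xs) i ≡ f (lookup xs (cast (length-map f xs) i))
lookup-map f (x ∷ xs) zero    = refl
lookup-map f (x ∷ xs) (suc i) = lookup-map f xs i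

Position : List ℕ → Set
Position ls = Σ[ i ∈ Fin (length ls) ] Fin (lookup ls i)

shift : ∀ l ls → Position ls → Position (l ∷ ls)
shift l ls (i , p) = suc i , p

branchPositions : (ls : List ℕ) → List (Position ls)
branchPositions []       = []
branchPositions (l ∷ ls) = map (zero ,_) (allFin l) ++ map (shift l ls) (branchPositions ls)

length-branchPositions : ∀ ls → length (branchPositions ls) ≡ sum ls
length-branchPositions []       = refl
length-branchPositions (l ∷ ls) = trans (length-++ (map (zero ,_) (allFin l)))
  (cong₂ _+_ (trans (length-map _ (allFin l)) (length-allFin l))
             (trans (length-map _ (branchPositions ls)) (length-branchPositions ls)))

branchPositions-unique : ∀ ls → Unique (branchPositions ls)
branchPositions-unique []       = []
branchPositions-unique (l ∷ ls) = Unique.++⁺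
  (Unique.map⁺ (λ { refl → refl }) (Unique.allFin⁺ l))
  (Unique.map⁺ (λ { refl → refl }) (branchPositions-unique ls))
  disjoint
  where
  disjoint : ∀ {x : Position (l ∷ ls)} → ¬ (x ∈ map (zero ,_) (allFin l) × x ∈ map (shift l ls) (branchPositions ls))
  disjoint (a , b) with ∈-map⁻ (zero ,_) a | ∈-map⁻ (shift l ls) b
  ... | _ , _ , refl | _ , _ , ()

-- The centre and all branch positions, carried over to the vertices of `G`, form a list without
-- repetition.
order-starlike : ∀ {n ls} {G : Graph (Fin n)} → G ≅ starlike ls → suc (sum ls) ≤ n
order-starlike {n} {ls} (f , _) = begin
  suc (sum ls)                                  ≡⟨ cong suc (length-branchPositions ls) ⟨
  suc (length (branchPositions ls))             ≡⟨ cong suc (length-map _ (branchPositions ls)) ⟨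
  length (centre ∷ map position (branchPositions ls))
    ≡⟨ length-map from (centre ∷ map position (branchPositions ls)) ⟨
  length (map from (centre ∷ map position (branchPositions ls)))
    ≤⟨ Unique-length-≤ (Unique.map⁺ from-injective uniq) (λ _ → ∈-allFin _) ⟩
  length (allFin n)                             ≡⟨ length-allFin n ⟩
  n ∎
  where
  open ≤-Reasoning
  open Inverse f using (from; to; strictlyInverseˡ)
  position : Position ls → StarlikeVertex ls
  position (i , p) = branch i p
  from-injective : ∀ {x y} → from x ≡ from y → x ≡ y
  from-injective eq = trans (sym (strictlyInverseˡ _)) (trans (cong to eq) (strictlyInverseˡ _))
  uniq : Unique (centre ∷ map position (branchPositions ls))
  uniq = tabulateAll not-centre ∷ Unique.map⁺ (λ { refl → refl }) (branchPositions-unique ls)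
    where
    not-centre : ∀ {x} → x ∈ map position (branchPositions ls) → centre ≢ x
    not-centre x∈ refl with ∈-map⁻ position x∈
    ... | _ , _ , ()

-- Legs of a tree with at most one vertex of degree above 2

module Legs {n : ℕ} (T : FiniteGraph n) (tree : IsTree (FiniteGraph.graph T)) (c : Fin n)
            (spike : ∀ {v} → v ≢ c → degree T v ≤ 2) where
  open FiniteGraph T
  open Rooted T tree c

  -- For `v` other than `c`, the ancestor at depth 1; it names the leg that contains `v`.
  top : Fin n → Fin n
  top v = ancestor (depth v ∸ 1) v

  ancestor-parent : ∀ m v → ancestor (suc m) v ≡ ancestor m (parent v)
  ancestor-parent m v = trans (cong (λ z → ancestor z v) (+-comm 1 m)) (sym (ancestor-+ m 1 v))

  depth-top : ∀ {v} → v ≢ c → depth (top v) ≡ 1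
  depth-top {v} v≢c = trans (depth-ancestor (depth v ∸ 1) v)
    (subst (λ d → d ∸ (d ∸ 1) ≡ 1) (sym (depth-parent v≢c)) (m+n∸n≡m 1 (depth (parent v))))

  depth≡1⇒parent≡c : ∀ {v} → depth v ≡ 1 → parent v ≡ c
  depth≡1⇒parent≡c {v} eq = depth≡0⇒root (trans (depth-parent-∸ v) (cong (_∸ 1) eq))

  suc⇒≢c : ∀ {v m} → depth v ≡ suc m → v ≢ c
  suc⇒≢c eq = depth>0⇒≢root (subst (0 <_) (sym eq) z<s)

  depth≡1⇒adj : ∀ {v} → depth v ≡ 1 → Adj c v
  depth≡1⇒adj eq = symmetric (subst (Adj _) (depth≡1⇒parent≡c eq) (parent-adj (suc⇒≢c eq)))

  adj⇒depth≡1 : ∀ {v} → Adj c v → depth v ≡ 1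
  adj⇒depth≡1 a with adj⇒parent a
  ... | inj₁ p = trans (isParentOf-depth p) (cong suc depth-root)
  ... | inj₂ (c≢c , _) = ⊥-elim (c≢c refl)

  top-self : ∀ {v} → depth v ≡ 1 → top v ≡ v
  top-self {v} eq = cong (λ d → ancestor (d ∸ 1) v) eq

  top-parent : ∀ {v m} → depth v ≡ 2 + m → top (parent v) ≡ top v
  top-parent {v} {m} eq = begin
    ancestor (depth (parent v) ∸ 1) (parent v)
      ≡⟨ cong (λ d → ancestor (d ∸ 1) (parent v)) (trans (depth-parent-∸ v) (cong (_∸ 1) eq)) ⟩
    ancestor m (parent v)     ≡⟨ ancestor-parent m v ⟨
    ancestor (suc m) v        ≡⟨ cong (λ d → ancestor (d ∸ 1) v) eq ⟨
    ancestor (depth v ∸ 1) v  ∎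
    where open ≡-Reasoning

  -- Two children and the parent would give `p` three neighbours.
  only-child : ∀ {p u v} → p ≢ c → IsParentOf p u → IsParentOf p v → u ≡ v
  only-child {p} {u} {v} p≢c pu pv with u Fin.≟ v
  ... | yes u≡v = u≡v
  ... | no u≢v  = ⊥-elim (<⇒≱ (degree-≥ T {xs = u ∷ v ∷ parent p ∷ []}
          ((u≢v ∷ not-parent pu ∷ []) ∷ (not-parent pv ∷ []) ∷ [] ∷ [])
          λ { (here refl) → isParentOf-adj pu
            ; (there (here refl)) → isParentOf-adj pv
            ; (there (there (here refl))) → parent-adj p≢c }) (spike p≢c))
    where
    not-parent : ∀ {x} → IsParentOf p x → x ≢ parent p
    not-parent px refl = isParentOf-asym px (p≢c , refl)

  -- Depth and leg are coordinates: by induction the parents coincide, and away from the root a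
  -- parent has only one child.
  leg-unique : ∀ m {u v} → depth u ≡ suc m → depth v ≡ suc m → top u ≡ top v → u ≡ v
  leg-unique zero    du dv eq = trans (sym (top-self du)) (trans eq (top-self dv))
  leg-unique (suc m) {u} {v} du dv eq = only-child (suc⇒≢c dpu) (suc⇒≢c du , refl) (suc⇒≢c dv , sym same)
    where
    dpu : depth (parent u) ≡ suc m
    dpu = trans (depth-parent-∸ u) (cong (_∸ 1) du)
    same : parent u ≡ parent v
    same = leg-unique m dpu (trans (depth-parent-∸ v) (cong (_∸ 1) dv))
             (trans (top-parent du) (trans eq (sym (top-parent dv))))

  -- Depth along the leg of `w` and 0 elsewhere. As `w` itself scores 1, a vertex of maximal score
  -- is the end of that leg.
  score : Fin n → Fin n → ℕ
  score w v = if does (top v Fin.≟ w) then depth v else 0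

  score-top : ∀ {w v} → top v ≡ w → score w v ≡ depth v
  score-top {w} {v} eq with top v Fin.≟ w
  ... | yes _ = refl
  ... | no ne = ⊥-elim (ne eq)

  score>0⇒top : ∀ {w v} → 0 < score w v → top v ≡ w
  score>0⇒top {w} {v} pos with top v Fin.≟ w
  ... | yes eq = eq

  abstract
    bottom : Fin n → Fin n
    bottom w = argmax (score w) w (allFin n)

    score≤bottom : ∀ w v → score w v ≤ score w (bottom w)
    score≤bottom w v = lookupAll (f[xs]≤f[argmax] {f = score w} w (allFin n)) (∈-allFin v)

  legLength : Fin n → ℕ
  legLength w = depth (bottom w)

  module _ {w : Fin n} (dw : depth w ≡ 1) where

    top-bottom : top (bottom w) ≡ w
    top-bottom = score>0⇒top (≤-trans (≤-reflexive (sym (trans (score-top (top-self dw)) dw))) (score≤bottom w w))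

    depth≤legLength : ∀ {v} → top v ≡ w → depth v ≤ legLength w
    depth≤legLength {v} eq =
      subst₂ _≤_ (score-top eq) (score-top top-bottom) (score≤bottom w v)

    1≤legLength : 1 ≤ legLength w
    1≤legLength = ≤-trans (≤-reflexive (sym dw)) (depth≤legLength (top-self dw))

  legVertex : Fin n → ℕ → Fin n
  legVertex w m = ancestor (legLength w ∸ m) (bottom w)

  depth-legVertex : ∀ {w m} → m ≤ legLength w → depth (legVertex w m) ≡ m
  depth-legVertex {w} {m} m≤ = trans (depth-ancestor (legLength w ∸ m) (bottom w)) (m∸[m∸n]≡n m≤)

  top-legVertex : ∀ {w m} → depth w ≡ 1 → suc m ≤ legLength w → top (legVertex w (suc m)) ≡ w
  top-legVertex {w} {m} dw m≤ = begin
    ancestor (depth (legVertex w (suc m)) ∸ 1) (legVertex w (suc m))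
      ≡⟨ cong (λ d → ancestor (d ∸ 1) (legVertex w (suc m))) (depth-legVertex m≤) ⟩
    ancestor m (ancestor (legLength w ∸ suc m) (bottom w))
      ≡⟨ ancestor-+ m (legLength w ∸ suc m) (bottom w) ⟩
    ancestor (m + (legLength w ∸ suc m)) (bottom w)
      ≡⟨ cong (λ d → ancestor d (bottom w)) (cong (_∸ 1) (m+[n∸m]≡n m≤)) ⟩
    top (bottom w)
      ≡⟨ top-bottom dw ⟩
    w ∎
    where open ≡-Reasoning

  neighbours : List (Fin n)
  neighbours = filter (adj? c) (allFin n)

  legLengths : List ℕ
  legLengths = map legLength neighbours

  length-legLengths : length legLengths ≡ degree T c
  length-legLengths = length-map legLength neighbours

  neighbour : Fin (length legLengths) → Fin n
  neighbour i = lookup neighbours (cast length-legLengths i)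

  depth-neighbour : ∀ i → depth (neighbour i) ≡ 1
  depth-neighbour i = adj⇒depth≡1 (proj₂ (∈-filter⁻ (adj? c) {xs = allFin n}
    (∈-lookup {xs = neighbours} (cast length-legLengths i))))

  lookup-injective : {A : Set} {xs : List A} → Unique xs → ∀ i j → lookup xs i ≡ lookup xs j → i ≡ j
  lookup-injective (x∉ ∷ u) zero    zero    eq = refl
  lookup-injective (x∉ ∷ u) zero    (suc j) eq = ⊥-elim (lookupAll x∉ (∈-lookup j) eq)
  lookup-injective (x∉ ∷ u) (suc i) zero    eq = ⊥-elim (lookupAll x∉ (∈-lookup i) (sym eq))
  lookup-injective (x∉ ∷ u) (suc i) (suc j) eq = cong suc (lookup-injective u i j eq)

  neighbour-injective : ∀ {i j} → neighbour i ≡ neighbour j → i ≡ j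
  neighbour-injective {i} {j} eq = Fin.toℕ-injective (begin
    toℕ i                          ≡⟨ Fin.toℕ-cast length-legLengths i ⟨
    toℕ (cast length-legLengths i) ≡⟨ cong toℕ (lookup-injective (Unique.filter⁺ (adj? c) (Unique.allFin⁺ n)) _ _ eq) ⟩
    toℕ (cast length-legLengths j) ≡⟨ Fin.toℕ-cast length-legLengths j ⟩
    toℕ j                          ∎)
    where open ≡-Reasoning

  neighbour-surjective : ∀ {w} → depth w ≡ 1 → ∃[ i ] neighbour i ≡ w
  neighbour-surjective {w} dw = cast (sym length-legLengths) (index w∈) ,
    trans (cong (lookup neighbours) (Fin.cast-involutive length-legLengths (sym length-legLengths) _))
          (sym (lookup-index w∈))
    where
    w∈ : w ∈ neighbours
    w∈ = ∈-filter⁺ (adj? c) (∈-allFin w) (depth≡1⇒adj dw)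

  lookup-legLengths : ∀ i → lookup legLengths i ≡ legLength (neighbour i)
  lookup-legLengths i = lookup-map legLength neighbours i

  1≤legLengths : ∀ i → 1 ≤ lookup legLengths i
  1≤legLengths i = subst (1 ≤_) (sym (lookup-legLengths i)) (1≤legLength (depth-neighbour i))

  locate : StarlikeVertex legLengths → Fin n
  locate centre       = c
  -- Position 0 of a branch is at depth 1.
  locate (branch i p) = legVertex (neighbour i) (suc (toℕ p))

  position≤ : ∀ i (p : Fin (lookup legLengths i)) → suc (toℕ p) ≤ legLength (neighbour i)
  position≤ i p = subst (suc (toℕ p) ≤_) (lookup-legLengths i) (Fin.toℕ<n p)

  depth-locate : ∀ i p → depth (locate (branch i p)) ≡ suc (toℕ p)
  depth-locate i p = depth-legVertex (position≤ i p)

  top-locate : ∀ i p → top (locate (branch i p)) ≡ neighbour i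
  top-locate i p = top-legVertex (depth-neighbour i) (position≤ i p)

  locate-injective : ∀ {x y} → locate x ≡ locate y → x ≡ y
  locate-injective {centre}     {centre}     eq = refl
  locate-injective {centre}     {branch i p} eq = ⊥-elim (suc⇒≢c (depth-locate i p) (sym eq))
  locate-injective {branch i p} {centre}     eq = ⊥-elim (suc⇒≢c (depth-locate i p) eq)
  locate-injective {branch i p} {branch j q} eq
    with neighbour-injective {i} {j} (trans (sym (top-locate i p)) (trans (cong top eq) (top-locate j q)))
  ... | refl = cong (branch i) (Fin.toℕ-injective (suc-injective
                 (trans (sym (depth-locate i p)) (trans (cong depth eq) (depth-locate i q)))))

  locate-surjective : ∀ v → ∃[ x ] locate x ≡ v
  locate-surjective v with v Fin.≟ c
  ... | yes refl = centre , refl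
  ... | no v≢c with neighbour-surjective (depth-top v≢c)
  ... | i , eq = branch i p , leg-unique _ (trans (depth-locate i p) (cong suc toℕ-p)) (depth-parent v≢c)
                   (trans (top-locate i p) eq)
    where
    bound : depth (parent v) < lookup legLengths i
    bound = subst₂ _≤_ (depth-parent v≢c) (sym (lookup-legLengths i))
              (depth≤legLength (depth-neighbour i) (sym eq))
    p : Fin (lookup legLengths i)
    p = fromℕ< bound
    toℕ-p : toℕ p ≡ depth (parent v)
    toℕ-p = Fin.toℕ-fromℕ< bound

  locate-child : ∀ i (p q : Fin (lookup legLengths i)) → suc (toℕ p) ≡ toℕ q →
                 IsParentOf (locate (branch i p)) (locate (branch i q))
  locate-child i p q eq = suc⇒≢c dq , leg-unique (toℕ p)
    (trans (depth-parent-∸ _) (cong (_∸ 1) dq)) (depth-locate i p)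
    (trans (top-parent dq) (trans (top-locate i q) (sym (top-locate i p))))
    where
    dq : depth (locate (branch i q)) ≡ 2 + toℕ p
    dq = trans (depth-locate i q) (cong suc (sym eq))

  parent-locate : ∀ {i p j q} → IsParentOf (locate (branch i p)) (locate (branch j q)) →
                  i ≡ j × suc (toℕ p) ≡ toℕ q
  parent-locate {i} {p} {j} {q} pq =
    neighbour-injective (trans (sym (top-locate i p)) (trans (cong top (sym (proj₂ pq)))
      (trans (top-parent dq) (top-locate j q)))) ,
    suc-injective (trans (sym dq) (depth-locate j q))
    where
    dq : depth (locate (branch j q)) ≡ 2 + toℕ p
    dq = trans (isParentOf-depth pq) (cong suc (depth-locate i p))

  locate-adj : ∀ x y → StarlikeAdj legLengths x y ⇔ Adj (locate x) (locate y)
  locate-adj centre centre = mk⇔ (λ ()) loopless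
  locate-adj centre (branch i p) = mk⇔
    (λ eq → depth≡1⇒adj (trans (depth-locate i p) (cong suc eq)))
    (λ a → suc-injective (trans (sym (depth-locate i p)) (adj⇒depth≡1 a)))
  locate-adj (branch i p) centre = mk⇔
    (λ eq → symmetric (depth≡1⇒adj (trans (depth-locate i p) (cong suc eq))))
    (λ a → suc-injective (trans (sym (depth-locate i p)) (adj⇒depth≡1 (symmetric a))))
  locate-adj (branch i p) (branch j q) = mk⇔
    (λ { (refl , inj₁ eq) → isParentOf-adj (locate-child i p q eq)
       ; (refl , inj₂ eq) → symmetric (isParentOf-adj (locate-child i q p eq)) })
    λ a → back (adj⇒parent a)
    where
    back : _ ⊎ _ → _
    back (inj₁ pq) = let e , f = parent-locate pq in e , inj₁ f
    back (inj₂ qp) = let e , f = parent-locate qp in sym e , inj₂ f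

  isStarlike : graph ≅ starlike legLengths
  isStarlike = embedding⇒≅ graph (starlike legLengths) locate locate-injective locate-surjective locate-adj

branch-index : ∀ {ls i j} {p : Fin (lookup ls i)} {q : Fin (lookup ls j)} →
               branch {ls} i p ≡ branch j q → i ≡ j
branch-index refl = refl

starlike-reindex : ∀ {ls ls′} (π : Fin (length ls′) ↔ Fin (length ls)) →
                   (∀ i → lookup ls′ i ≡ lookup ls (Inverse.to π i)) → starlike ls ≅ starlike ls′
starlike-reindex {ls} {ls′} π same = embedding⇒≅ (starlike ls) (starlike ls′) move move-injective surj adj
  where
  open Inverse π using (to; from; strictlyInverseˡ; strictlyInverseʳ)
  move : StarlikeVertex ls′ → StarlikeVertex ls
  move centre       = centre
  move (branch i p) = branch (to i) (cast (same i) p)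

  toℕ-eq : ∀ {i : Fin (length ls)} {p q : Fin (lookup ls i)} → branch {ls} i p ≡ branch i q → toℕ p ≡ toℕ q
  toℕ-eq refl = refl

  to-injective : ∀ {i j} → to i ≡ to j → i ≡ j
  to-injective eq = trans (sym (strictlyInverseʳ _)) (trans (cong from eq) (strictlyInverseʳ _))

  move-injective : ∀ {x y} → move x ≡ move y → x ≡ y
  move-injective {centre}     {centre}     eq = refl
  move-injective {branch i p} {branch j q} eq with to-injective (branch-index eq)
  ... | refl = cong (branch i) (Fin.toℕ-injective (trans (sym (Fin.toℕ-cast (same i) p))
                 (trans (toℕ-eq eq) (Fin.toℕ-cast (same i) q))))

  surj : ∀ y → ∃[ x ] move x ≡ y
  surj centre       = centre , refl
  surj (branch j q) = onto (strictlyInverseˡ j) q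
    where
    onto : ∀ {i j} → to i ≡ j → (q : Fin (lookup ls j)) → ∃[ x ] move x ≡ branch j q
    onto {i} refl q = branch i (cast (sym (same i)) q) ,
      cong (branch (to i)) (Fin.toℕ-injective (trans (Fin.toℕ-cast (same i) _) (Fin.toℕ-cast (sym (same i)) q)))

  adj : ∀ x y → StarlikeAdj ls′ x y ⇔ StarlikeAdj ls (move x) (move y)
  adj centre       centre       = mk⇔ (λ ()) (λ ())
  adj centre       (branch i p) = mk⇔ (trans (Fin.toℕ-cast (same i) p)) (trans (sym (Fin.toℕ-cast (same i) p)))
  adj (branch i p) centre       = mk⇔ (trans (Fin.toℕ-cast (same i) p)) (trans (sym (Fin.toℕ-cast (same i) p)))
  adj (branch i p) (branch j q)
    rewrite Fin.toℕ-cast (same i) p | Fin.toℕ-cast (same j) q =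
    mk⇔ (λ (e , a) → cong to e , a) (λ (e , a) → to-injective e , a)

-- Only the multiset of branch lengths matters. The permutation is reversed because
-- `starlike-reindex` sends new branch indices to old ones.
starlike-↭ : ∀ {ls ls′} → ls ↭ ls′ → starlike ls ≅ starlike ls′
starlike-↭ {ls} {ls′} perm = starlike-reindex (Permutationₛ.onIndices perm′)
                               (Permutationₛ.onIndices-lookup (setoid ℕ) perm′)
  where perm′ = ↭⇒↭ₛ (↭-sym perm)

-- Walks in starlike trees

module StarlikeWalks (ls : List ℕ) where
  private
    S = starlike ls

  forward : ∀ m i (p q : Fin (lookup ls i)) → toℕ q ≡ m + toℕ p → WithinDistance S m (branch i p) (branch i q)
  forward zero    i p q eq with Fin.toℕ-injective eq
  ... | refl = ε , z≤n
  forward (suc m) i p q eq with forward m i next q (trans eq (trans (sym (+-suc m (toℕ p))) (cong (m +_) (sym toℕ-next))))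
    where
    bound : suc (toℕ p) < lookup ls i
    bound = ≤-trans (s≤s (s≤s (m≤n+m (toℕ p) m))) (≤-trans (s≤s (≤-reflexive (sym eq))) (Fin.toℕ<n q))
    next : Fin (lookup ls i)
    next = fromℕ< bound
    toℕ-next : toℕ next ≡ suc (toℕ p)
    toℕ-next = Fin.toℕ-fromℕ< bound
  ... | w , w≤ = (refl , inj₁ (sym (Fin.toℕ-fromℕ< _))) ◅ w , s≤s w≤

  -- The two hypotheses say that the positions differ by at most `m`, without subtraction.
  sameBranch : ∀ {m} i (p q : Fin (lookup ls i)) → toℕ q ≤ m + toℕ p → toℕ p ≤ m + toℕ q →
               WithinDistance S m (branch i p) (branch i q)
  sameBranch {m} i p q q≤ p≤ with ≤-total (toℕ p) (toℕ q)
  ... | inj₁ p≤q = within-weaken S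
                     (≤-trans (∸-monoˡ-≤ (toℕ p) q≤) (≤-reflexive (m+n∸n≡m m (toℕ p))))
                     (forward (toℕ q ∸ toℕ p) i p q (sym (m∸n+n≡m p≤q)))
  ... | inj₂ q≤p = within-sym S (within-weaken S
                     (≤-trans (∸-monoˡ-≤ (toℕ q) p≤) (≤-reflexive (m+n∸n≡m m (toℕ q))))
                     (forward (toℕ p ∸ toℕ q) i q p (sym (m∸n+n≡m q≤p))))

  toCentre : ∀ i (p : Fin (lookup ls i)) → WithinDistance S (suc (toℕ p)) (branch i p) centre
  toCentre i p = within-weaken S (≤-reflexive (+-comm (toℕ p) 1))
    (within-trans S (within-sym S (forward (toℕ p) i first p
      (sym (trans (cong (toℕ p +_) toℕ-first) (+-identityʳ _))))) (toℕ-first ◅ ε , ≤-refl))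
    where
    bound : 0 < lookup ls i
    bound = ≤-trans (s≤s z≤n) (Fin.toℕ<n p)
    first : Fin (lookup ls i)
    first = fromℕ< bound
    toℕ-first : toℕ first ≡ 0
    toℕ-first = Fin.toℕ-fromℕ< bound

  module _ (stops : ∀ i → List (Fin (lookup ls i))) where

    spread : List (StarlikeVertex ls)
    spread = concat (map (λ i → map (branch i) (stops i)) (allFin (length ls)))

    ∈-spread : ∀ {i p} → p ∈ stops i → branch {ls} i p ∈ spread
    ∈-spread {i} p∈ = ∈-concat⁺′ (∈-map⁺ (branch i) p∈) (∈-map⁺ (λ i → map (branch i) (stops i)) (∈-allFin i))

    length-spread : length spread ≡ sum (map (λ i → length (stops i)) (allFin (length ls)))
    length-spread = go (allFin (length ls))
      where
      on : Fin (length ls) → List (StarlikeVertex ls)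
      on i = map (branch i) (stops i)
      go : ∀ is → length (concat (map on is)) ≡ sum (map (λ i → length (stops i)) is)
      go []       = refl
      go (i ∷ is) = trans (length-++ (on i)) (cong₂ _+_ (length-map (branch {ls} i) (stops i)) (go is))

within-transport : {V W : Set} {G : Graph V} {H : Graph W} (iso : G ≅ H) → ∀ {m} (u : V) {y} →
                   WithinDistance H m (Inverse.to (proj₁ iso) u) y →
                   WithinDistance G m u (Inverse.from (proj₁ iso) y)
within-transport {G = G} {H} (f , adj) u (w , w≤) = subst₂ (WithinDistance G _) (strictlyInverseʳ u) refl (go w w≤)
  where
  open Inverse f using (to; from; strictlyInverseˡ; strictlyInverseʳ)
  go : ∀ {m x y} (w : Walk H x y) → walkLength H w ≤ m → WithinDistance G m (from x) (from y)
  go ε _ = ε , z≤n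
  go (a ◅ w) (s≤s w≤) =
    let w′ , w′≤ = go w w≤ in
    Equivalence.from (adj _ _) (subst₂ (Graph.Adj H) (sym (strictlyInverseˡ _)) (sym (strictlyInverseˡ _)) a) ◅ w′ ,
    s≤s w′≤

all-lookup : {A : Set} {P : A → Set} (xs : List A) → (∀ i → P (lookup xs i)) → All P xs
all-lookup []       p = []
all-lookup (x ∷ xs) p = p zero ∷ all-lookup xs (p ∘ suc)

extract : {A : Set} {P : A → Set} (xs : List A) (j : Fin (length xs)) →
          (∀ i → i ≢ j → P (lookup xs i)) → ∃[ ys ] (xs ↭ lookup xs j ∷ ys × All P ys)
extract (x ∷ xs) zero    p = xs , ↭-refl , all-lookup xs (λ i → p (suc i) λ ())
extract (x ∷ xs) (suc j) p with extract xs j (λ i i≢j → p (suc i) (i≢j ∘ Fin.suc-injective))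
... | ys , perm , all = x ∷ ys , ↭-trans (prep x perm) (swap x _ ↭-refl) , p zero (λ ()) ∷ all

two-valued : {A : Set} {x y : A} {zs : List A} → All (λ z → z ≡ x ⊎ z ≡ y) zs →
             ∃[ a ] ∃[ b ] zs ↭ replicate a x ++ replicate b y
two-valued [] = 0 , 0 , ↭-refl
two-valued {x = x} {y} (z≡ ∷ all) with two-valued all | z≡
... | a , b , perm | inj₁ refl = suc a , b , prep x perm
... | a , b , perm | inj₂ refl = a , suc b ,
  ↭-trans (prep y perm) (↭-sym (↭.shift y (replicate a x) (replicate b y)))

-- Branch lengths forced by the domination number

-- The equation `order` says that k γ vertices remain when one leaf is removed from each branch.
module LegCombinatorics {n : ℕ} (T : FiniteGraph n) {ls : List ℕ} (iso : FiniteGraph.graph T ≅ starlike ls)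
  (l>0 : ∀ i → 1 ≤ lookup ls i) {k γ : ℕ} (1≤k : 1 ≤ k)
  (dom : IsDistanceDominationNumber T k γ) (order : n ≡ k * γ + length ls) (γ≥3 : 3 ≤ γ) where

  open StarlikeWalks ls

  indices : List (Fin (length ls))
  indices = allFin (length ls)

  cover : (xs : List (StarlikeVertex ls)) →
          (∀ y → ∃[ x ] (x ∈ xs × WithinDistance (starlike ls) k y x)) → γ ≤ length xs
  cover xs near = ≤-trans
    (covering-list-length T dom (map from xs) λ v → let x , x∈ , d = near (to v) in
      from x , ∈-map⁺ from x∈ , within-transport {G = FiniteGraph.graph T} {starlike ls} iso v d)
    (≤-reflexive (length-map from xs))
    where open Inverse (proj₁ iso) using (to; from)

  -- One vertex covers at most 2k + 1 vertices of a branch: itself and k on either side.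
  K : ℕ
  K = suc (k + k)

  -- A branch of length l is covered by the centre together with the vertices
  -- at depths K, 2K, …, the last one being moved back to the leaf if needed.
  abstract
    stopCount : ℕ → ℕ
    stopCount l = (l + k) / K

    stopCount*K≤ : ∀ l → stopCount l * K ≤ l + k
    stopCount*K≤ l = m/n*n≤m (l + k) K

    <stopCount*K : ∀ l → l ≤ stopCount l * K + k
    <stopCount*K l = ≤-pred (+-cancelʳ-≤ k _ _ (begin
      suc l + k                           ≡⟨⟩
      suc (l + k)                         ≡⟨ cong suc (m≡m%n+[m/n]*n (l + k) K) ⟩
      suc ((l + k) % K + stopCount l * K) ≤⟨ +-monoˡ-≤ (stopCount l * K) (m%n<n (l + k) K) ⟩
      K + stopCount l * K                 ≡⟨ eq k (stopCount l * K) ⟩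
      suc (stopCount l * K + k) + k       ∎))
      where
      open ≤-Reasoning
      eq : ∀ k x → suc (k + k) + x ≡ suc (x + k) + k
      eq = solve-∀

    stopCount-mono : ∀ {l m} → l ≤ m → stopCount l ≤ stopCount m
    stopCount-mono l≤m = /-monoˡ-≤ K (+-monoˡ-≤ k l≤m)

    stopCount-k : stopCount k ≡ 0
    stopCount-k = m<n⇒m/n≡0 {k + k} {K} ≤-refl

    stopCount-k+1 : stopCount (k + 1) ≡ 1
    stopCount-k+1 = trans (cong (_/ K) (trans (+-assoc k 1 k) (+-suc k k))) (n/n≡1 K)

    stopCount-1 : stopCount 1 ≡ 0
    stopCount-1 = m<n⇒m/n≡0 {1 + k} {K} (s≤s (+-monoˡ-≤ k 1≤k))

  rest : ℕ → ℕ
  rest l = (l ∸ 1) ∸ k * stopCount l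

  -- Rearranges q K ≤ l + k for q = s + 1. The first term makes `rest` an untruncated difference;
  -- the second shows that two or more stops would leave a remainder above k.
  leg-bound : ∀ {l s} → 1 ≤ l → stopCount l ≡ suc s → k * suc s + s * suc k ≤ l ∸ 1
  leg-bound {suc l} {s} _ eq = ≤-pred (+-cancelʳ-≤ k _ _ (begin
    suc (k * suc s + s * suc k) + k   ≡⟨ shuffle k s ⟩
    suc s * K                         ≡⟨ cong (_* K) eq ⟨
    stopCount (suc l) * K             ≤⟨ stopCount*K≤ (suc l) ⟩
    suc l + k                         ∎))
    where
    open ≤-Reasoning
    shuffle : ∀ k s → suc (k * suc s + s * suc k) + k ≡ suc s * suc (k + k)
    shuffle = solve-∀

  leg-split : ∀ {l} → 1 ≤ l → l ≡ suc (k * stopCount l + rest l)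
  leg-split {suc l} 1≤l = cong suc (sym (m+[n∸m]≡n (below (stopCount (suc l)) refl)))
    where
    below : ∀ q → stopCount (suc l) ≡ q → k * stopCount (suc l) ≤ l
    below zero eq    = ≤-trans (≤-reflexive (trans (cong (k *_) eq) (*-zeroʳ k))) z≤n
    below (suc s) eq = ≤-trans (≤-reflexive (cong (k *_) eq)) (≤-trans (m≤m+n _ _) (leg-bound 1≤l eq))

  stopCount≤1 : ∀ {l} → 1 ≤ l → rest l < k → stopCount l ≤ 1
  stopCount≤1 {l} 1≤l r<k = below (stopCount l) refl
    where
    below : ∀ q → stopCount l ≡ q → stopCount l ≤ 1
    below zero eq          = ≤-trans (≤-reflexive eq) z≤n
    below (suc zero) eq    = ≤-reflexive eq
    below (suc (suc s)) eq = ⊥-elim (<⇒≱ r<k (begin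
      k                                           ≤⟨ ≤-trans (n≤1+n k) (m≤m+n (suc k) (s * suc k)) ⟩
      suc s * suc k                               ≡⟨ m+n∸m≡n (k * suc (suc s)) (suc s * suc k) ⟨
      (k * suc (suc s) + suc s * suc k) ∸ k * suc (suc s) ≤⟨ ∸-monoˡ-≤ (k * suc (suc s)) (leg-bound 1≤l eq) ⟩
      (l ∸ 1) ∸ k * suc (suc s)                   ≡⟨ cong (λ q → (l ∸ 1) ∸ k * q) eq ⟨
      rest l                                      ∎))
      where open ≤-Reasoning

  q r : Fin (length ls) → ℕ
  q i = stopCount (lookup ls i)
  r i = rest (lookup ls i)

  ∑ : (Fin (length ls) → ℕ) → ℕ
  ∑ f = sum (map f indices)

  pred-< : ∀ {a l} → 0 < l → a ≤ l → a ∸ 1 < l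
  pred-< {zero}  0<l _   = 0<l
  pred-< {suc a} _   a≤l = a≤l

  -- A vertex at depth d is served by the multiple of `K` nearest to d, capped at the leaf. It has
  -- number `stopCount d`, and number 0 is the centre.
  γ≤1+∑q : γ ≤ suc (∑ q)
  γ≤1+∑q = ≤-trans (cover (centre ∷ spread stops) near)
    (≤-reflexive (cong suc (trans (length-spread stops) (Sum.⨁-cong indices length-stops))))
    where
    -- Stop number s, counted from 0, has depth min (l, (s + 1) K) and hence position one less.
    stop< : ∀ i s → (lookup ls i ⊓ (suc s * K)) ∸ 1 < lookup ls i
    stop< i s = pred-< (l>0 i) (m⊓n≤m (lookup ls i) (suc s * K))
    stops : ∀ i → List (Fin (lookup ls i))
    stops i = map (λ s → fromℕ< (stop< i s)) (upTo (q i))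
    length-stops : ∀ i → length (stops i) ≡ q i
    length-stops i = trans (length-map (λ s → fromℕ< (stop< i s)) (upTo (q i))) (length-upTo (q i))
    near : ∀ y → ∃[ x ] (x ∈ centre ∷ spread stops × WithinDistance (starlike ls) k y x)
    near centre = centre , here refl , within-refl (starlike ls)
    near (branch i p) = byCases (stopCount (suc (toℕ p))) refl
      where
      l = lookup ls i
      byCases : ∀ t → stopCount (suc (toℕ p)) ≡ t →
                ∃[ x ] (x ∈ centre ∷ spread stops × WithinDistance (starlike ls) k (branch i p) x)
      byCases zero eq = centre , here refl , within-weaken (starlike ls)
        (≤-trans (<stopCount*K (suc (toℕ p))) (≤-reflexive (cong (λ t → t * K + k) eq))) (toCentre i p)
      byCases (suc s) eq = branch i (fromℕ< (stop< i s)) ,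
        there (∈-spread stops (∈-map⁺ _ (∈-upTo⁺ (≤-trans (≤-reflexive (sym eq))
          (stopCount-mono (Fin.toℕ<n p)))))) ,
        sameBranch i p (fromℕ< (stop< i s))
          (subst (_≤ k + toℕ p) (sym (Fin.toℕ-fromℕ< (stop< i s))) (begin
            (l ⊓ (suc s * K)) ∸ 1      ≤⟨ ∸-monoˡ-≤ 1 (m⊓n≤n l (suc s * K)) ⟩
            suc s * K ∸ 1            ≡⟨ cong (λ t → t * K ∸ 1) eq ⟨
            stopCount (suc (toℕ p)) * K ∸ 1 ≤⟨ ∸-monoˡ-≤ 1 (stopCount*K≤ (suc (toℕ p))) ⟩
            toℕ p + k                ≡⟨ +-comm (toℕ p) k ⟩
            k + toℕ p                ∎))
          (subst (λ z → toℕ p ≤ k + z) (sym (Fin.toℕ-fromℕ< (stop< i s))) (predˡ (begin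
            suc (toℕ p)                      ≤⟨ ⊓-glb (≤-trans (Fin.toℕ<n p) (m≤m+n l k))
                                                  (≤-trans (<stopCount*K (suc (toℕ p))) (≤-reflexive (cong (λ t → t * K + k) eq))) ⟩
            (l + k) ⊓ (suc s * K + k)        ≡⟨ +-distribʳ-⊓ k l (suc s * K) ⟨
            (l ⊓ (suc s * K)) + k              ≡⟨ +-comm _ k ⟩
            k + (l ⊓ (suc s * K))              ∎)))
        where
        open ≤-Reasoning
        predˡ : ∀ {a x} → suc a ≤ k + x → a ≤ k + (x ∸ 1)
        predˡ {a} {zero}  h = ≤-trans (n≤1+n a) h
        predˡ {a} {suc x} h = ≤-pred (≤-trans h (≤-reflexive (+-suc k x)))

  sum≡∑ : sum ls ≡ ∑ (lookup ls)
  sum≡∑ = cong sum (sym (trans (map-tabulate id (lookup ls)) (tabulate-lookup ls)))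

  ∑-split : sum ls ≡ length ls + (k * ∑ q + ∑ r)
  ∑-split = begin
    sum ls                                     ≡⟨ sum≡∑ ⟩
    ∑ (lookup ls)                              ≡⟨ Sum.⨁-cong indices (λ i → leg-split (l>0 i)) ⟩
    ∑ (λ i → 1 + (k * q i + r i))              ≡⟨ Sum.⨁-distrib (λ _ → 1) _ indices ⟩
    ∑ (λ _ → 1) + ∑ (λ i → k * q i + r i)
      ≡⟨ cong₂ _+_ (trans (sym (length≡sum indices)) (length-allFin (length ls))) (Sum.⨁-distrib (λ i → k * q i) r indices) ⟩
    length ls + (∑ (λ i → k * q i) + ∑ r)      ≡⟨ cong (λ z → length ls + (z + ∑ r)) (scale indices) ⟩
    length ls + (k * ∑ q + ∑ r)                ∎
    where
    open ≡-Reasoning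
    scale : ∀ is → sum (map (λ i → k * q i) is) ≡ k * sum (map q is)
    scale []       = sym (*-zeroʳ k)
    scale (i ∷ is) = trans (cong (k * q i +_) (scale is)) (sym (*-distribˡ-+ k (q i) _))

  -- The order counts the centre and all branches; one vertex per branch cancels against the branch
  -- count in `order`.
  budget : suc (k * ∑ q + ∑ r) ≤ k * γ
  budget = +-cancelˡ-≤ (length ls) _ _ (begin
    length ls + suc (k * ∑ q + ∑ r)   ≡⟨ +-suc (length ls) _ ⟩
    suc (length ls + (k * ∑ q + ∑ r)) ≡⟨ cong suc ∑-split ⟨
    suc (sum ls)                      ≤⟨ ≤-trans (order-starlike {G = FiniteGraph.graph T} iso) (≤-reflexive order) ⟩
    k * γ + length ls                 ≡⟨ +-comm (k * γ) _ ⟩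
    length ls + k * γ                 ∎)
    where open ≤-Reasoning

  -- The upper bound from the order meets the lower bound from domination, k γ ≤ k ∑ q + k, and what
  -- is left for the remainders is less than k.
  ∑r<k : ∑ r < k
  ∑r<k = +-cancelˡ-≤ (k * ∑ q) _ _ (begin
    k * ∑ q + suc (∑ r)     ≡⟨ +-suc (k * ∑ q) _ ⟩
    suc (k * ∑ q + ∑ r)     ≤⟨ budget ⟩
    k * γ                   ≤⟨ *-monoʳ-≤ k γ≤1+∑q ⟩
    k * suc (∑ q)           ≡⟨ *-suc k (∑ q) ⟩
    k + k * ∑ q             ≡⟨ +-comm k _ ⟩
    k * ∑ q + k             ∎)
    where open ≤-Reasoning

  ∑q<γ : ∑ q < γ
  ∑q<γ = *-cancelˡ-< k _ _ (≤-trans (s≤s (m≤m+n _ (∑ r))) budget)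

  ∑-≥ : ∀ {is} → Unique is → sum (map r is) ≤ ∑ r
  ∑-≥ uniq = Unique-sum-≤ r uniq (λ _ → ∈-allFin _)

  r<k : ∀ i → r i < k
  r<k i = ≤-trans (s≤s (≤-trans (≤-reflexive (sym (+-identityʳ (r i)))) (∑-≥ {i ∷ []} ([] ∷ [])))) ∑r<k

  q≤1 : ∀ i → q i ≤ 1
  q≤1 i = stopCount≤1 (l>0 i) (r<k i)

  length-short : ∀ {i} → q i ≡ 0 → lookup ls i ≡ suc (r i)
  length-short {i} eq = trans (leg-split (l>0 i)) (cong suc
    (trans (cong (λ z → k * z + r i) eq) (cong (_+ r i) (*-zeroʳ k))))

  length-long : ∀ {i} → q i ≡ 1 → lookup ls i ≡ suc (k + r i)
  length-long {i} eq = trans (leg-split (l>0 i)) (cong suc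
    (trans (cong (λ z → k * z + r i) eq) (cong (_+ r i) (*-identityʳ k))))

  -- Otherwise the vertices at distance k from the leaves of the long legs
  -- dominate without the help of the centre.
  blocker : ∀ {i} → q i ≡ 1 → ∃[ j ] (q j ≡ 0 × k ≤ suc (r i + r j))
  blocker {i} qi≡1 with Fin.any? (λ j → (q j ≟ 0) ×-dec (k ≤? suc (r i + r j)))
  ... | yes found = found
  ... | no none   = ⊥-elim (<⇒≱ ∑q<γ (≤-trans (cover (spread stops) near)
    (≤-reflexive (trans (length-spread stops) (Sum.⨁-cong indices length-stops)))))
    where
    -- The leaf has position `lookup ls i ∸ 1`, so this is the position at distance k from it; on a
    -- long branch it equals `r i`.
    stop< : ∀ i → lookup ls i ∸ suc k < lookup ls i
    stop< i = below (l>0 i)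
      where
      below : ∀ {l} → 1 ≤ l → l ∸ suc k < l
      below {suc l} _ = s≤s (m∸n≤m l k)
    stops : ∀ i → List (Fin (lookup ls i))
    stops i = map (λ _ → fromℕ< (stop< i)) (upTo (q i))
    length-stops : ∀ i → length (stops i) ≡ q i
    length-stops i = trans (length-map (λ _ → fromℕ< (stop< i)) (upTo (q i))) (length-upTo (q i))
    mark : ∀ i → Fin (lookup ls i)
    mark i = fromℕ< (stop< i)
    mark∈ : ∀ {i} → q i ≡ 1 → branch i (mark i) ∈ spread stops
    mark∈ {i} eq = ∈-spread stops (∈-map⁺ (λ _ → fromℕ< (stop< i)) (∈-upTo⁺ {i = 0} (≤-reflexive (sym eq))))
    toℕ-mark : ∀ {i} → q i ≡ 1 → toℕ (mark i) ≡ r i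
    toℕ-mark {i} eq = trans (Fin.toℕ-fromℕ< (stop< i))
      (trans (cong (_∸ suc k) (length-long eq)) (m+n∸m≡n (suc k) (r i)))
    -- A short branch reaches the mark through the centre in at most (r j + 1) + (r i + 1) steps,
    -- which is at most k in the absence of a blocker.
    viaCentre : ∀ {j} → q j ≡ 0 → (p : Fin (lookup ls j)) →
                WithinDistance (starlike ls) k (branch j p) (branch i (mark i))
    viaCentre {j} qj≡0 p = within-weaken (starlike ls) (begin
      suc (toℕ p) + suc (toℕ (mark i))  ≤⟨ +-mono-≤ (Fin.toℕ<n p) (s≤s (≤-reflexive (toℕ-mark qi≡1))) ⟩
      lookup ls j + suc (r i)           ≡⟨ cong (_+ suc (r i)) (length-short qj≡0) ⟩
      suc (r j) + suc (r i)             ≡⟨ shuffle (r j) (r i) ⟩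
      suc (suc (r i + r j))             ≤⟨ ≰⇒> (λ k≤ → none (j , qj≡0 , k≤)) ⟩
      k ∎) (within-trans (starlike ls) (toCentre j p) (within-sym (starlike ls) (toCentre i (mark i))))
      where
      open ≤-Reasoning
      shuffle : ∀ a b → suc a + suc b ≡ suc (suc (b + a))
      shuffle = solve-∀
    near : ∀ y → ∃[ x ] (x ∈ spread stops × WithinDistance (starlike ls) k y x)
    near centre = branch i (mark i) , mark∈ qi≡1 , within-weaken (starlike ls)
      (≤-trans (s≤s (≤-reflexive (toℕ-mark qi≡1))) (r<k i)) (within-sym (starlike ls) (toCentre i (mark i)))
    near (branch j p) with q j in eq | q≤1 j
    ... | zero  | _ = branch i (mark i) , mark∈ qi≡1 , viaCentre eq p
    ... | suc zero | _ = branch j (mark j) , mark∈ eq , sameBranch j p (mark j)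
      (≤-trans (≤-reflexive (toℕ-mark eq)) (≤-trans (<⇒≤ (r<k j)) (m≤m+n k (toℕ p))))
      (≤-pred (≤-trans (Fin.toℕ<n p) (≤-reflexive (trans (length-long eq) (cong (λ z → suc (k + z)) (sym (toℕ-mark eq)))))))
    ... | suc (suc _) | s≤s ()

  -- All remainders add up to at most k - 1, and those of `i` and `j` already use this up.
  zero-elsewhere : ∀ {i j x} → i ≢ j → x ≢ i → x ≢ j → k ≤ suc (r i + r j) → r x ≡ 0
  zero-elsewhere {i} {j} {x} i≢j x≢i x≢j k≤ = n≤0⇒n≡0 (+-cancelʳ-≤ (r i + r j) _ _ (≤-pred (begin
    suc (r x + (r i + r j))           ≡⟨ cong (λ z → suc (r x + (r i + z))) (+-identityʳ (r j)) ⟨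
    suc (r x + (r i + (r j + 0)))     ≤⟨ s≤s (∑-≥ ((x≢i ∷ x≢j ∷ []) ∷ (i≢j ∷ []) ∷ [] ∷ [])) ⟩
    suc (∑ r)                         ≤⟨ ∑r<k ⟩
    k                                 ≤⟨ k≤ ⟩
    suc (r i + r j)                   ∎)))
    where open ≤-Reasoning

  one-long : ∀ is → 1 ≤ sum (map q is) → ∃[ i ] (i ∈ is × q i ≡ 1)
  one-long (i ∷ is) pos with q i in eq | q≤1 i
  ... | zero        | _ = let j , j∈ , qj = one-long is pos in j , there j∈ , qj
  ... | suc zero    | _ = i , here refl , eq
  ... | suc (suc _) | s≤s ()

  two-long : ∀ {is} → Unique is → 2 ≤ sum (map q is) → ∃[ i ] ∃[ j ] (i ≢ j × q i ≡ 1 × q j ≡ 1)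
  two-long {i ∷ is} (i∉ ∷ uniq) 2≤ with q i in eq | q≤1 i
  ... | zero        | _ = two-long uniq 2≤
  ... | suc zero    | _ = let j , j∈ , qj = one-long is (≤-pred 2≤) in i , j , lookupAll i∉ j∈ , eq , qj
  ... | suc (suc _) | s≤s ()

  -- As γ ≥ 3 there are two long branches i and i′. With its blocker, i uses up all remainders, so r
  -- i′ = 0; the blocker j′ of i′ then has remainder k - 1 and length k, and every other remainder
  -- is 0.
  leg-shape : ∃[ j ] (lookup ls j ≡ k × (∀ x → x ≢ j → lookup ls x ≡ k + 1 ⊎ lookup ls x ≡ 1))
  leg-shape with two-long (Unique.allFin⁺ (length ls)) (≤-pred (≤-trans γ≥3 γ≤1+∑q))
  ... | i , i′ , i≢i′ , qi , qi′ with blocker qi | blocker qi′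
  ... | j , qj , k≤ | j′ , qj′ , k≤′ =
    j′ , trans (length-short qj′) (≤-antisym (r<k j′) (subst (λ z → k ≤ suc (z + r j′)) ri′≡0 k≤′)) , others
    where
    differ : ∀ {x y} → q x ≡ 1 → q y ≡ 0 → x ≢ y
    differ qx qy refl = 1+n≢0 (trans (sym qx) qy)
    ri′≡0 : r i′ ≡ 0
    ri′≡0 = zero-elsewhere (differ qi qj) (i≢i′ ∘ sym) (differ qi′ qj) k≤
    r≡0 : ∀ x → x ≢ j′ → r x ≡ 0
    r≡0 x x≢j′ with x Fin.≟ i′
    ... | yes refl = ri′≡0
    ... | no x≢i′  = zero-elsewhere (differ qi′ qj′) x≢i′ x≢j′ k≤′
    others : ∀ x → x ≢ j′ → lookup ls x ≡ k + 1 ⊎ lookup ls x ≡ 1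
    others x x≢j′ with q x in eq | q≤1 x
    ... | zero        | _ = inj₂ (trans (length-short eq) (cong suc (r≡0 x x≢j′)))
    ... | suc zero    | _ = inj₁ (trans (length-long eq) (trans (cong (λ z → suc (k + z)) (r≡0 x x≢j′))
                              (trans (cong suc (+-identityʳ k)) (+-comm 1 k))))
    ... | suc (suc _) | s≤s ()

  -- The multiplicities are forced: branches of length k + 1 carry one stop and the others none, so
  -- a = ∑ q = γ - 1, and `b` follows from the order.
  module _ {a b : ℕ} (perm : ls ↭ k ∷ replicate a (k + 1) ++ replicate b 1) where
    private
      sum-replicate : ∀ m x → sum (replicate m x) ≡ m * x
      sum-replicate zero    x = refl
      sum-replicate (suc m) x = cong (x +_) (sum-replicate m x)
      ∑q≡a : ∑ q ≡ a
      ∑q≡a = begin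
        ∑ q
          ≡⟨ cong sum (trans (map-tabulate id q) (trans (sym (map-tabulate (lookup ls) stopCount))
               (cong (map stopCount) (tabulate-lookup ls)))) ⟩
        sum (map stopCount ls)                        ≡⟨ sum-↭ (↭.map⁺ stopCount perm) ⟩
        stopCount k + sum (map stopCount (replicate a (k + 1) ++ replicate b 1))
          ≡⟨ cong₂ _+_ stopCount-k (cong sum (trans (map-++ stopCount (replicate a (k + 1)) _)
               (cong₂ _++_ (map-replicate stopCount a (k + 1)) (map-replicate stopCount b 1)))) ⟩
        sum (replicate a (stopCount (k + 1)) ++ replicate b (stopCount 1))
          ≡⟨ cong₂ (λ s t → sum (replicate a s ++ replicate b t))
               stopCount-k+1 stopCount-1 ⟩
        sum (replicate a 1 ++ replicate b 0)          ≡⟨ sum-++ (replicate a 1) _ ⟩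
        sum (replicate a 1) + sum (replicate b 0)     ≡⟨ cong₂ _+_ (sum-replicate a 1) (sum-replicate b 0) ⟩
        a * 1 + b * 0                                 ≡⟨ eq a b ⟩
        a                                             ∎
        where
        open ≡-Reasoning
        eq : ∀ a b → a * 1 + b * 0 ≡ a
        eq = solve-∀
      γ≡ : γ ≡ suc a
      γ≡ = trans (≤-antisym γ≤1+∑q ∑q<γ) (cong suc ∑q≡a)
      a≡ : a ≡ γ ∸ 1
      a≡ = sym (cong (_∸ 1) γ≡)
      b≡ : b ≡ n ∸ (k + 1) * γ
      b≡ = begin
        b                                             ≡⟨ m+n∸m≡n ((k + 1) * γ) b ⟨
        ((k + 1) * γ + b) ∸ (k + 1) * γ               ≡⟨ cong (λ z → ((k + 1) * z + b) ∸ (k + 1) * γ) γ≡ ⟩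
        ((k + 1) * suc a + b) ∸ (k + 1) * γ           ≡⟨ cong (_∸ (k + 1) * γ) (eq k a b) ⟩
        (k * suc a + suc (a + b)) ∸ (k + 1) * γ       ≡⟨ cong₂ (λ z L → (k * z + L) ∸ (k + 1) * γ) (sym γ≡) (sym count) ⟩
        (k * γ + length ls) ∸ (k + 1) * γ             ≡⟨ cong (_∸ (k + 1) * γ) order ⟨
        n ∸ (k + 1) * γ                               ∎
        where
        open ≡-Reasoning
        eq : ∀ k a b → (k + 1) * suc a + b ≡ k * suc a + suc (a + b)
        eq = solve-∀
        count : length ls ≡ suc (a + b)
        count = trans (↭.↭-length perm) (cong suc (trans (length-++ (replicate a (k + 1)))
          (cong₂ _+_ (length-replicate a) (length-replicate b))))

    branchLengths-↭ : ls ↭ branchLengths n k γ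
    branchLengths-↭ = subst (ls ↭_) (cong₂ (λ s t → k ∷ replicate s (k + 1) ++ replicate t 1) a≡ b≡) perm

  legs-↭ : ls ↭ branchLengths n k γ
  legs-↭ =
    let j , lj≡k , others = leg-shape
        xs , ls↭ , shape = extract ls j others
        a , b , xs↭ = two-valued shape
    in branchLengths-↭ {a} {b} (↭-trans ls↭
         (subst (λ l → l ∷ xs ↭ k ∷ replicate a (k + 1) ++ replicate b 1) (sym lj≡k) (prep k xs↭)))

  isExtremal : FiniteGraph.graph T ≅ T[ n , k , γ ]
  isExtremal = ≅-trans {G = FiniteGraph.graph T} {starlike ls} {T[ n , k , γ ]} iso (starlike-↭ legs-↭)

-- The extremal tree

module StarlikeDegrees {n : ℕ} (T : FiniteGraph n) {ls : List ℕ} (iso : FiniteGraph.graph T ≅ starlike ls)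
                       (l>0 : ∀ i → 1 ≤ lookup ls i) where
  open FiniteGraph T
  open Inverse (proj₁ iso) using (to; from; strictlyInverseˡ; strictlyInverseʳ)

  hub : Fin n
  hub = from centre

  adj⇒starlikeAdj : ∀ {x v} → Adj (from x) v → StarlikeAdj ls x (to v)
  adj⇒starlikeAdj {x} a = subst (λ z → StarlikeAdj ls z _) (strictlyInverseˡ x) (Equivalence.to (proj₂ iso _ _) a)

  starlikeAdj⇒adj : ∀ {x y} → StarlikeAdj ls x y → Adj (from x) (from y)
  starlikeAdj⇒adj {x} {y} a = Equivalence.from (proj₂ iso _ _)
    (subst₂ (StarlikeAdj ls) (sym (strictlyInverseˡ x)) (sym (strictlyInverseˡ y)) a)

  first : (i : Fin (length ls)) → Fin (lookup ls i)
  first i = fromℕ< (l>0 i)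

  toℕ-first : ∀ i → toℕ (first i) ≡ 0
  toℕ-first i = Fin.toℕ-fromℕ< (l>0 i)

  tip : Fin (length ls) → Fin n
  tip i = from (branch i (first i))

  tip-injective : ∀ {i j} → tip i ≡ tip j → i ≡ j
  tip-injective eq = branch-index (trans (sym (strictlyInverseˡ _)) (trans (cong to eq) (strictlyInverseˡ _)))

  degree-hub : degree T hub ≡ length ls
  degree-hub = ≤-antisym
    (≤-trans (degree-≤ T λ v a → subst (_∈ tips) (strictlyInverseʳ v) (atTip (to v) (adj⇒starlikeAdj a)))
             (≤-reflexive length-tips))
    (≤-trans (≤-reflexive (sym length-tips))
             (degree-≥ T (Unique.map⁺ tip-injective (Unique.allFin⁺ (length ls))) (adjacent ∘ ∈-map⁻ tip)))
    where
    tips : List (Fin n)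
    tips = map tip (allFin (length ls))
    length-tips : length tips ≡ length ls
    length-tips = trans (length-map tip (allFin (length ls))) (length-allFin (length ls))
    atTip : ∀ y → StarlikeAdj ls centre y → from y ∈ tips
    atTip (branch i p) p≡0 = subst (λ z → from (branch i z) ∈ tips)
      (Fin.toℕ-injective (trans (toℕ-first i) (sym p≡0))) (∈-map⁺ tip (∈-allFin i))
    adjacent : ∀ {v} → ∃[ i ] (i ∈ allFin (length ls) × v ≡ tip i) → Adj hub v
    adjacent (i , _ , refl) = starlikeAdj⇒adj {centre} {branch i (first i)} (toℕ-first i)

  degree-nonhub : ∀ {v} → v ≢ hub → degree T v ≤ 2
  degree-nonhub {v} v≢hub = subst (λ u → degree T u ≤ 2) (strictlyInverseʳ v)
    (onBranch (to v) λ eq → v≢hub (trans (sym (strictlyInverseʳ v)) (cong from eq)))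
    where
    onBranch : ∀ x → x ≢ centre → degree T (from x) ≤ 2
    onBranch centre ne = ⊥-elim (ne refl)
    onBranch (branch i p) _ = degree-≤ T {xs = from inner ∷ from outer ∷ []}
      λ u a → subst (_∈ from inner ∷ from outer ∷ []) (strictlyInverseʳ u) (among (to u) (adj⇒starlikeAdj a))
      where
      inner outer : StarlikeVertex ls
      inner with toℕ p ≟ 0
      ... | yes _ = centre
      ... | no _  = branch i (Fin.pred p)
      outer with suc (toℕ p) <? lookup ls i
      ... | yes p< = branch i (fromℕ< p<)
      -- At the end of the branch there is no outer neighbour; the centre is a harmless default,
      -- since only an upper bound on the degree is sought.
      ... | no _   = centre

      inner-centre : toℕ p ≡ 0 → centre ≡ inner
      inner-centre p≡0 with toℕ p ≟ 0
      ... | yes _  = refl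
      ... | no p≢0 = ⊥-elim (p≢0 p≡0)

      toℕ-pred : ∀ {l} (p : Fin l) → toℕ (Fin.pred p) ≡ pred (toℕ p)
      toℕ-pred zero    = refl
      toℕ-pred (suc p) = Fin.toℕ-inject₁ p

      inner-branch : ∀ {q} → suc (toℕ q) ≡ toℕ p → branch i q ≡ inner
      inner-branch {q} eq with toℕ p ≟ 0
      ... | yes p≡0 = ⊥-elim (1+n≢0 (trans eq p≡0))
      ... | no _    = cong (branch i) (Fin.toℕ-injective (trans (cong pred eq) (sym (toℕ-pred p))))

      outer-branch : ∀ {q} → suc (toℕ p) ≡ toℕ q → branch i q ≡ outer
      outer-branch {q} eq with suc (toℕ p) <? lookup ls i
      ... | yes p< = cong (branch i) (Fin.toℕ-injective (trans (sym eq) (sym (Fin.toℕ-fromℕ< p<))))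
      ... | no p≮  = ⊥-elim (p≮ (subst (_< lookup ls i) (sym eq) (Fin.toℕ<n q)))

      among : ∀ y → StarlikeAdj ls (branch i p) y → from y ∈ from inner ∷ from outer ∷ []
      among centre       p≡0               = here (cong from (inner-centre p≡0))
      among (branch _ q) (refl , inj₁ eq) = there (here (cong from (outer-branch eq)))
      among (branch _ q) (refl , inj₂ eq) = here (cong from (inner-branch eq))

branchLengths>0 : ∀ n {k} γ → 1 ≤ k → All (1 ≤_) (branchLengths n k γ)
branchLengths>0 n {k} γ 1≤k = 1≤k ∷ All.++⁺ (All.replicate⁺ (γ ∸ 1) (≤-trans 1≤k (m≤m+n k 1)))
                                             (All.replicate⁺ (n ∸ (k + 1) * γ) ≤-refl)

length-branchLengths : ∀ n k {γ} → 1 ≤ γ → length (branchLengths n k γ) ≡ γ + (n ∸ (k + 1) * γ)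
length-branchLengths n k {suc γ} _ = cong suc (trans (length-++ (replicate γ (k + 1)))
  (cong₂ _+_ (length-replicate γ) (length-replicate (n ∸ (k + 1) * suc γ))))

-- The bounds and the case of equality

module Extremality (n k γ : ℕ) (k≥2 : k ≥ 2) (γ≥3 : γ ≥ 3) (T : FiniteGraph n)
                   (tree : IsTree (FiniteGraph.graph T)) (dom : IsDistanceDominationNumber T k γ) where
  open FiniteGraph T
  open DegreeCounts (degree T)

  1≤k : 1 ≤ k
  1≤k = <⇒≤ k≥2

  vs : List (Fin n)
  vs = allFin n

  -- If `v` were the only vertex, it would dominate alone, against γ ≥ 3; otherwise a walk to
  -- another vertex has a first edge.
  degree>0 : ∀ v → 1 ≤ degree T v
  degree>0 v with Fin.any? (λ u → ¬? (u Fin.≟ v))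
  ... | yes (u , u≢v) = firstEdge (IsTree.connected tree v u)
    where
    firstEdge : Walk graph v u → 1 ≤ degree T v
    firstEdge ε       = ⊥-elim (u≢v refl)
    firstEdge (a ◅ _) = degree-≥ T {xs = _ ∷ []} ([] ∷ []) λ { (here refl) → a }
  ... | no none = ⊥-elim (<⇒≱ (<⇒≤ γ≥3) (covering-list-length T dom (v ∷ []) λ u →
      v , here refl , subst (λ z → WithinDistance graph k z v) (sym (same u)) (within-refl graph)))
    where
    same : ∀ u → u ≡ v
    same u = decidable-stable (u Fin.≟ v) (λ u≢v → none (u , u≢v))

  -- `t` counts the internal vertices beyond k γ, and `p` the vertices of degree 2 in the extremal
  -- tree.
  X t p : ℕ
  X = excess vs
  t = twoPlus vs ∸ k * γ
  p = k * γ ∸ 1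

  kγ>0 : 1 ≤ k * γ
  kγ>0 = *-mono-≤ 1≤k (≤-trans (s≤s z≤n) γ≥3)

  suc-p : suc p ≡ k * γ
  suc-p = m+[n∸m]≡n kγ>0

  kγ≤internal : k * γ ≤ twoPlus vs
  kγ≤internal = DominationBound.k*γ≤internalCount T tree k γ {{>-nonZero 1≤k}} (<⇒≤ γ≥3) dom

  internal-split : twoPlus vs ≡ suc p + t
  internal-split = trans (sym (m+[n∸m]≡n kγ≤internal)) (cong (_+ t) (sym suc-p))

  -- With the degrees summed, the handshake identity reads 2n = n + I + X + 2, where I = k γ + t.
  order-split : n ≡ k * γ + (2 + (X + t))
  order-split = sym (+-cancelˡ-≡ n _ _ (begin
    n + (k * γ + (2 + (X + t)))      ≡⟨ shuffle n (k * γ) X t ⟩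
    n + (k * γ + t) + X + 2          ≡⟨ cong (λ z → n + z + X + 2) (m+[n∸m]≡n kγ≤internal) ⟩
    n + twoPlus vs + X + 2           ≡⟨ cong (λ z → z + twoPlus vs + X + 2) (length-allFin n) ⟨
    length vs + twoPlus vs + X + 2   ≡⟨ cong (_+ 2) (sum-degrees {vs} (tabulateAll λ {v} _ → degree>0 v)) ⟨
    _ + 2                            ≡⟨ Rooted.handshake T tree (IsTree.nonempty tree) ⟩
    n + n                            ∎))
    where
    open ≡-Reasoning
    shuffle : ∀ n a x t → n + (a + (2 + (x + t))) ≡ n + (a + t) + x + 2
    shuffle = solve-∀

  n∸kγ : n ∸ k * γ ≡ 2 + (X + t)
  n∸kγ = trans (cong (_∸ k * γ) order-split) (m+n∸m≡n (k * γ) _)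

  IsExtremal : Set
  IsExtremal = graph ≅ T[ n , k , γ ]

  -- The spike is the centre and has 2 + X legs, so `order-split` with t = 0 is the counting
  -- condition of `LegCombinatorics`.
  spike⇒extremal : t ≡ 0 → Spike vs → IsExtremal
  spike⇒extremal t≡0 (c , dc , others) =
    LegCombinatorics.isExtremal T {Legs.legLengths T tree c spike} (Legs.isStarlike T tree c spike)
      (Legs.1≤legLengths T tree c spike) 1≤k dom order γ≥3
    where
    spike : ∀ {v} → v ≢ c → degree T v ≤ 2
    spike = others (∈-allFin _)
    order : n ≡ k * γ + length (Legs.legLengths T tree c spike)
    order = trans order-split (cong (k * γ +_) (trans (cong (λ z → 2 + (X + z)) t≡0)
      (trans (cong (2 +_) (+-identityʳ X)) (trans (sym dc) (sym (Legs.length-legLengths T tree c spike))))))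

  module _ (iso : IsExtremal) where
    open StarlikeDegrees T {branchLengths n k γ} iso
      (λ i → lookupAll (branchLengths>0 n γ 1≤k) (∈-lookup i))

    degree-centre : degree T hub ≡ γ + (n ∸ (k + 1) * γ)
    degree-centre = trans degree-hub (length-branchLengths n k (≤-trans (s≤s z≤n) γ≥3))

    3≤⇒hub : ∀ {v} → 3 ≤ degree T v → v ≡ hub
    3≤⇒hub {v} 3≤ = decidable-stable (v Fin.≟ hub) (λ v≢hub → <⇒≱ 3≤ (degree-nonhub v≢hub))

    not-two-branching : ¬ TwoBranching
    not-two-branching (u , v , u≢v , du , dv) = u≢v (trans (3≤⇒hub du) (sym (3≤⇒hub dv)))

    -- The hub has degree at least 3, so it is the spike, and its two degree formulas agree: 2 + X =
    -- γ + (n ∸ (k + 1) γ). Substituted in `order-split`, this leaves no room for `t`.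
    no-surplus : Spike vs → t ≡ 0
    no-surplus (c , dc , others) with hub Fin.≟ c
    ... | no hub≢c = ⊥-elim (<⇒≱ (≤-trans γ≥3 (≤-trans (m≤m+n γ _) (≤-reflexive (sym degree-centre))))
                                 (others (∈-allFin hub) hub≢c))
    ... | yes hub≡c = exact ((k + 1) * γ ≤? n)
      where
      open ≡-Reasoning
      shuffle : ∀ k γ m t → k * γ + (γ + m + t) ≡ ((k + 1) * γ + m) + t
      shuffle = solve-∀
      total : n ≡ ((k + 1) * γ + (n ∸ (k + 1) * γ)) + t
      total = begin
        n                                            ≡⟨ order-split ⟩
        k * γ + (2 + X + t)
          ≡⟨ cong (λ z → k * γ + (z + t)) (trans (sym dc) (trans (cong (degree T) (sym hub≡c)) degree-centre)) ⟩
        k * γ + (γ + (n ∸ (k + 1) * γ) + t)          ≡⟨ shuffle k γ (n ∸ (k + 1) * γ) t ⟩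
        ((k + 1) * γ + (n ∸ (k + 1) * γ)) + t        ∎
      exact : Dec ((k + 1) * γ ≤ n) → t ≡ 0
      exact (yes fits) = +-cancelˡ-≡ n t 0
        (trans (cong (_+ t) (sym (m+[n∸m]≡n fits))) (trans (sym total) (sym (+-identityʳ n))))
      -- Truncation cannot occur: `total` itself gives (k + 1) γ ≤ n.
      exact (no small) = ⊥-elim (small (≤-trans (≤-trans (m≤m+n _ _) (m≤m+n _ t)) (≤-reflexive (sym total))))

  -- Every cause of strictness also rules out the isomorphism, so one dichotomy yields both the
  -- bound and its equality case.
  resolve : ∀ {P B : ℕ} {S : Set} →
            (P ≡ B × t ≡ 0 × Spike vs) ⊎ (S × (TwoBranching ⊎ 0 < t × Spike vs)) →
            (P ≡ B × IsExtremal) ⊎ (S × ¬ IsExtremal)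
  resolve (inj₁ (eq , t≡0 , spike))       = inj₁ (eq , spike⇒extremal t≡0 spike)
  resolve (inj₂ (s , inj₁ two))           = inj₂ (s , λ iso → not-two-branching iso two)
  resolve (inj₂ (s , inj₂ (0<t , spike))) = inj₂ (s , λ iso → <⇒≢ 0<t (sym (no-surplus iso spike)))

  Π₁-dichotomy : (Π₁ T ≡ 4 ^ p * (n ∸ k * γ) ^ 2 × IsExtremal) ⊎
                 (Π₁ T > 4 ^ p * (n ∸ k * γ) ^ 2 × ¬ IsExtremal)
  Π₁-dichotomy rewrite n∸kγ = resolve (SquareProduct.extremal (degree T) {p = p} {t} (Unique.allFin⁺ n)
                  (tabulateAll λ {v} _ → degree>0 v) internal-split)

  Π₂-dichotomy : (Π₂ T ≡ 4 ^ p * (n ∸ k * γ) ^ (n ∸ k * γ) × IsExtremal) ⊎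
                 (Π₂ T < 4 ^ p * (n ∸ k * γ) ^ (n ∸ k * γ) × ¬ IsExtremal)
  Π₂-dichotomy rewrite n∸kγ | Π₂-vertices T = resolve (SelfPowerProduct.extremal (degree T) {p = p} {t} (Unique.allFin⁺ n)
                  (tabulateAll λ {v} _ → degree>0 v) internal-split)

theorem3p5 : (n k γ : ℕ) → k ≥ 2 → γ ≥ 3 →
    (T : FiniteGraph n) → IsTree (FiniteGraph.graph T) →
    IsDistanceDominationNumber T k γ →
    (Π₁ T ≥ 4 ^ (k * γ ∸ 1) * (n ∸ k * γ) ^ 2) ×
    (Π₂ T ≤ 4 ^ (k * γ ∸ 1) * (n ∸ k * γ) ^ (n ∸ k * γ)) ×
    (Π₁ T ≡ 4 ^ (k * γ ∸ 1) * (n ∸ k * γ) ^ 2 ⇔ FiniteGraph.graph T ≅ T[ n , k , γ ]) ×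
    (Π₂ T ≡ 4 ^ (k * γ ∸ 1) * (n ∸ k * γ) ^ (n ∸ k * γ) ⇔ FiniteGraph.graph T ≅ T[ n , k , γ ])
theorem3p5 n k γ k≥2 γ≥3 T tree dom =
  bound₁ Π₁-dichotomy , bound₂ Π₂-dichotomy , equality (≢-sym ∘ <⇒≢) Π₁-dichotomy , equality <⇒≢ Π₂-dichotomy
  where
  open Extremality n k γ k≥2 γ≥3 T tree dom
  bound₁ : ∀ {P B : ℕ} {E : Set} → (P ≡ B × E) ⊎ (P > B × ¬ E) → P ≥ B
  bound₁ (inj₁ (eq , _)) = ≤-reflexive (sym eq)
  bound₁ (inj₂ (gt , _)) = <⇒≤ gt
  bound₂ : ∀ {P B : ℕ} {E : Set} → (P ≡ B × E) ⊎ (P < B × ¬ E) → P ≤ B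
  bound₂ (inj₁ (eq , _)) = ≤-reflexive eq
  bound₂ (inj₂ (lt , _)) = <⇒≤ lt
  equality : ∀ {P B : ℕ} {S E : Set} → (S → P ≢ B) → (P ≡ B × E) ⊎ (S × ¬ E) → P ≡ B ⇔ E
  equality strict (inj₁ (eq , e))  = mk⇔ (λ _ → e) (λ _ → eq)
  equality strict (inj₂ (s , ¬e)) = mk⇔ (λ eq → ⊥-elim (strict s eq)) (λ e → ⊥-elim (¬e e))
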